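{- Let $T$ be a caterpillar with diameter $d$ and let $P: v_0, v_1, \ldots, v_d$ be a diametrical path of $T$ (a path of length $d=\operatorname{diam}(T)$). Then $\Gamma_b(T) = \operatorname{diam}(T)$ if and only if all of the following hold: (i) each $v_i$, $i \in \{1, \ldots, d-1\}$, is adjacent to at most two leaves; (ii) for any $i \in \{1, \ldots, d-2\}$, $\min\{\deg_T(v_i), \deg_T(v_{i+1})\} = 2$; (iii) whenever $v_i$ and $v_j$ with $i < j$ are each adjacent to at least two leaves, there exists an index $k$ with $i < k < j$ such that $\deg_T(v_k) = \deg_T(v_{k+1}) = 2$.
   Context: All graphs are finite, simple, connected and nontrivial. A caterpillar is a tree of order at least three whose removal of all leaves yields a path. For a graph $G=(V,E)$, a broadcast is a function $f: V \to \{0,1,\ldots,\operatorname{diam}(G)\}$ with $f(v) \le e(v)$ (the eccentricity of $v$) for all $v$. It is dominating if every $u \in V$ is at distance at most $f(v)$ from some $v$ with $f(v) \ge 1$. It is minimal dominating if it is dominating and no broadcast $f' \ne f$ with $f'(v)\le f(v)$ for all $v$ is dominating. The cost of $f$ is $\sigma(f)=\sum_{v\in V} f(v)$, and the upper broadcast domination number is $\Gamma_b(G)=\max\{\sigma(f): f \text{ is a minimal dominating broadcast on } G\}$. -}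

module Defs where

open import Data.Nat using (ℕ; zero; suc; _+_; _∸_; _≤_; _<_; _⊔_; _⊓_)
open import Data.Bool using (Bool; true; false; _∧_; _∨_; if_then_else_)
open import Data.Fin using (Fin; zero; suc; toℕ)
import Data.Fin as Fin
open import Data.Product using (Σ; _×_; _,_)
open import Data.Sum using (_⊎_)
open import Relation.Nullary using (¬_)
open import Relation.Nullary.Decidable using (⌊_⌋)
open import Relation.Binary.PropositionalEquality using (_≡_)

record Graph : Set where
  field
    n      : ℕ
    adj    : Fin n → Fin n → Bool
    sym    : ∀ u v → adj u v ≡ adj v u
    irrefl : ∀ u → adj u u ≡ false

open Graph public

Vertex : Graph → Set
Vertex G = Fin (n G)

Adj : (G : Graph) → Vertex G → Vertex G → Set
Adj G u v = adj G u v ≡ true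

countF : ∀ {m} → (Fin m → Bool) → ℕ
countF {zero}  p = 0
countF {suc m} p = (if p zero then 1 else 0) + countF (λ i → p (suc i))

anyF : ∀ {m} → (Fin m → Bool) → Bool
anyF {zero}  p = false
anyF {suc m} p = p zero ∨ anyF (λ i → p (suc i))

maxF : ∀ {m} → (Fin m → ℕ) → ℕ
maxF {zero}  f = 0
maxF {suc m} f = f zero ⊔ maxF (λ i → f (suc i))

sumF : ∀ {m} → (Fin m → ℕ) → ℕ
sumF {zero}  f = 0
sumF {suc m} f = f zero + sumF (λ i → f (suc i))

_==_ : ∀ {m} → Fin m → Fin m → Bool
u == v = ⌊ u Fin.≟ v ⌋

deg : (G : Graph) → Vertex G → ℕ
deg G u = countF (adj G u)

isLeaf : (G : Graph) → Vertex G → Bool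
isLeaf G u = ⌊ deg G u Data.Nat.≟ 1 ⌋
  where import Data.Nat

leafNeighbours : (G : Graph) → Vertex G → ℕ
leafNeighbours G u = countF (λ w → adj G u w ∧ isLeaf G w)

edgeCount : Graph → ℕ
edgeCount G = sumF (λ u → countF (λ v → adj G u v ∧ ⌊ toℕ u Data.Nat.<? toℕ v ⌋))
  where import Data.Nat

reach : (G : Graph) → ℕ → Vertex G → Vertex G → Bool
reach G zero    u v = u == v
reach G (suc k) u v = reach G k u v ∨ anyF (λ w → adj G u w ∧ reach G k w v)

Connected : Graph → Set
Connected G = ∀ u v → Σ ℕ (λ k → reach G k u v ≡ true)

-- least k < b with p k, and b if there is none
least : ℕ → (ℕ → Bool) → ℕ
least zero    p = zero
least (suc b) p = if p zero then zero else suc (least b (λ k → p (suc k)))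

-- d(u,v): the least k such that some walk of length ≤ k joins u and v
-- (in a connected graph on n vertices it is < n, so the search bound n suffices)
dist : (G : Graph) → Vertex G → Vertex G → ℕ
dist G u v = least (n G) (λ k → reach G k u v)

ecc : (G : Graph) → Vertex G → ℕ
ecc G v = maxF (dist G v)

diam : Graph → ℕ
diam G = maxF (ecc G)

IsTree : Graph → Set
IsTree G = Connected G × suc (edgeCount G) ≡ n G

LeafDeletionIsPath : Graph → Set
LeafDeletionIsPath G =
  Σ ℕ λ m → Σ (Fin (suc m) → Vertex G) λ w →
    (∀ i j → w i ≡ w j → i ≡ j) ×
    (∀ u → isLeaf G u ≡ false → Σ (Fin (suc m)) λ i → w i ≡ u) ×
    (∀ i → isLeaf G (w i) ≡ false) ×
    (∀ i j → (Adj G (w i) (w j) → (toℕ j ≡ suc (toℕ i) ⊎ toℕ i ≡ suc (toℕ j)))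
           × ((toℕ j ≡ suc (toℕ i) ⊎ toℕ i ≡ suc (toℕ j)) → Adj G (w i) (w j)))

IsCaterpillar : Graph → Set
IsCaterpillar G = IsTree G × 3 ≤ n G × LeafDeletionIsPath G

IsBroadcast : (G : Graph) → (Vertex G → ℕ) → Set
IsBroadcast G f = ∀ v → f v ≤ ecc G v

Dominating : (G : Graph) → (Vertex G → ℕ) → Set
Dominating G f = ∀ u → Σ (Vertex G) λ v → 1 ≤ f v × dist G v u ≤ f v

IsDominatingBroadcast : (G : Graph) → (Vertex G → ℕ) → Set
IsDominatingBroadcast G f = IsBroadcast G f × Dominating G f

MinimalDominating : (G : Graph) → (Vertex G → ℕ) → Set
MinimalDominating G f =
  IsDominatingBroadcast G f ×
  (∀ f' → IsBroadcast G f' → (∀ v → f' v ≤ f v) → ¬ (∀ v → f' v ≡ f v) →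
    ¬ Dominating G f')

cost : (G : Graph) → (Vertex G → ℕ) → ℕ
cost G f = sumF f

UpperBroadcastNumberIs : Graph → ℕ → Set
UpperBroadcastNumberIs G m =
  (Σ (Vertex G → ℕ) λ f → MinimalDominating G f × cost G f ≡ m) ×
  (∀ f → MinimalDominating G f → cost G f ≤ m)

-- Diametrical path v_0,…,v_d given as v : ℕ → Vertex (only indices ≤ d matter)

IsDiametricalPath : (G : Graph) → (d : ℕ) → (ℕ → Vertex G) → Set
IsDiametricalPath G d v =
  d ≡ diam G ×
  (∀ i j → i ≤ d → j ≤ d → v i ≡ v j → i ≡ j) ×
  (∀ i → i < d → Adj G (v i) (v (suc i)))

CondI : (G : Graph) → ℕ → (ℕ → Vertex G) → Set
CondI G d v = ∀ i → 1 ≤ i → i ≤ d ∸ 1 → leafNeighbours G (v i) ≤ 2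

CondII : (G : Graph) → ℕ → (ℕ → Vertex G) → Set
CondII G d v = ∀ i → 1 ≤ i → i ≤ d ∸ 2 → deg G (v i) ⊓ deg G (v (suc i)) ≡ 2

CondIII : (G : Graph) → ℕ → (ℕ → Vertex G) → Set
CondIII G d v = ∀ i j → i < j → j ≤ d →
  2 ≤ leafNeighbours G (v i) → 2 ≤ leafNeighbours G (v j) →
  Σ ℕ λ k → i < k × k < j × deg G (v k) ≡ 2 × deg G (v (suc k)) ≡ 2

{-# OPTIONS --safe #-}
-- The caterpillar has spine s_0, ..., s_m with m = d - 2. In a minimal dominating broadcast f every w
-- with f w ≥ 1 has a private vertex u_w, dominated by w alone; either d(w, u_w) = f w, or u_w = w and
-- f w = 1. Being private forces the paths from w to u_w to be disjoint on the spine, except that several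
-- leaves of one spine vertex may broadcast with strength 1 side by side. So f splits the spine into
-- blocks, and a block on k consecutive positions costs at most k + 1, with equality only for a path
-- between two leaves or for a pair of single leaves. If the conditions hold then, scanning the spine
-- from left to right, between two blocks of cost k + 1 there is a position outside all blocks or a block
-- of cost k - 1: after a leaf-to-leaf path the next position is already dominated and this propagates,
-- and after a pair of single leaves the only way to lose nothing alternates degrees ≥ 3 and 2 until the
-- next pair, which (iii) excludes. Hence f costs at most (m + 1) + 1 = d.
--
-- Conversely, if s_p and s_{p+1} both have degree ≥ 3, broadcasting p + 2 and m - p + 1 from the two ends
-- of the diametrical path costs d + 1. If that never happens but (i) fails at i = j or (iii) fails
-- between i and j, broadcast strength 1 from all leaves of s_i, ..., s_j and from the leafless vertices
-- among them, and i and m - j from the two ends.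
module Submission where

open import Defs
open import Data.Bool using (Bool; true; false; _∧_; _∨_; not; if_then_else_)
open import Data.Bool.Properties using (∨-zeroʳ) renaming (_≟_ to _≟ᵇ_)
open import Data.Empty using (⊥; ⊥-elim)
open import Data.Fin using (Fin; zero; suc; toℕ; fromℕ<) renaming (_≟_ to _≟ᶠ_)
open import Data.Fin.Properties using (any?; ¬∀⟶∃¬; injective⇒≤; toℕ<n; toℕ-fromℕ<; toℕ-injective)
open import Data.Nat using (ℕ; zero; suc; _+_; _∸_; _≤_; _<_; _⊔_; _⊓_; ∣_-_∣; z≤n; s≤s; _≟_; _≤?_; _<?_)
open import Data.Nat.Properties hiding (_≟_; _≤?_; _<?_)
open import Algebra.Properties.CommutativeSemigroup +-commutativeSemigroup
  using () renaming (interchange to +-interchange)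
open import Data.Product using (Σ; ∃; _×_; _,_; proj₁; proj₂)
open import Data.Sum using (_⊎_; inj₁; inj₂; [_,_]′; map₂)
open import Function using (_∘_; case_of_)
open import Function.Bundles using (_⇔_; mk⇔)
open import Relation.Nullary using (¬_; Dec; yes; no; contradiction)
open import Relation.Nullary.Decidable using (⌊_⌋; _×-dec_; ¬?)
open import Relation.Binary.PropositionalEquality
  using (_≡_; _≢_; refl; trans; cong; cong₂; subst; subst₂) renaming (sym to ≡-sym)
open import Relation.Binary.Definitions using (tri<; tri≈; tri>)

-- Booleans, finite sums and counting.

true≢false : ∀ {b} → b ≡ true → b ≡ false → ⊥
true≢false refl ()

¬true⇒false : ∀ {b} → ¬ (b ≡ true) → b ≡ false
¬true⇒false {true}  ne = contradiction refl ne
¬true⇒false {false} _  = refl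

∧-true⁻ : ∀ {a b} → a ∧ b ≡ true → a ≡ true × b ≡ true
∧-true⁻ {true} {true} refl = refl , refl

∧-true⁺ : ∀ {a b} → a ≡ true → b ≡ true → a ∧ b ≡ true
∧-true⁺ refl refl = refl

∨-true⁻ : ∀ {a b} → a ∨ b ≡ true → a ≡ true ⊎ b ≡ true
∨-true⁻ {true}  _ = inj₁ refl
∨-true⁻ {false} e = inj₂ e

∨-true⁺ˡ : ∀ {a} b → a ≡ true → a ∨ b ≡ true
∨-true⁺ˡ b refl = refl

∨-true⁺ʳ : ∀ a {b} → b ≡ true → a ∨ b ≡ true
∨-true⁺ʳ a refl = ∨-zeroʳ a

isYes⁻ : ∀ {A : Set} {d : Dec A} → ⌊ d ⌋ ≡ true → A
isYes⁻ {d = yes a} _ = a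

isYes⁺ : ∀ {A : Set} {d : Dec A} → A → ⌊ d ⌋ ≡ true
isYes⁺ {d = yes _} _ = refl
isYes⁺ {d = no ¬a} a = contradiction a ¬a

isYes-no : ∀ {A : Set} {d : Dec A} → ⌊ d ⌋ ≡ false → ¬ A
isYes-no {d = no ¬a} _ = ¬a

sumF-mono-≤ : ∀ {k} {f g : Fin k → ℕ} → (∀ i → f i ≤ g i) → sumF f ≤ sumF g
sumF-mono-≤ {zero}  le = z≤n
sumF-mono-≤ {suc k} le = +-mono-≤ (le zero) (sumF-mono-≤ (λ i → le (suc i)))

sumF-cong : ∀ {k} {f g : Fin k → ℕ} → (∀ i → f i ≡ g i) → sumF f ≡ sumF g
sumF-cong {zero}  eq = refl
sumF-cong {suc k} eq = cong₂ _+_ (eq zero) (sumF-cong (λ i → eq (suc i)))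

sumF-+ : ∀ {k} (f g : Fin k → ℕ) → sumF (λ i → f i + g i) ≡ sumF f + sumF g
sumF-+ {zero}  f g = refl
sumF-+ {suc k} f g = trans (cong (f zero + g zero +_) (sumF-+ (f ∘ suc) (g ∘ suc)))
  (+-interchange (f zero) (g zero) _ _)

sumF-0 : ∀ k → sumF {k} (λ _ → 0) ≡ 0
sumF-0 zero    = refl
sumF-0 (suc k) = sumF-0 k

single : ∀ {k} → Fin k → ℕ → Fin k → ℕ
single zero    a zero    = a
single zero    a (suc _) = 0
single (suc w) a zero    = 0
single (suc w) a (suc i) = single w a i

single-at : ∀ {k} (w : Fin k) a → single w a w ≡ a
single-at zero    a = refl
single-at (suc w) a = single-at w a

single-off : ∀ {k} (w i : Fin k) a → i ≢ w → single w a i ≡ 0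
single-off zero    zero    a ne = contradiction refl ne
single-off zero    (suc i) a ne = refl
single-off (suc w) zero    a ne = refl
single-off (suc w) (suc i) a ne = single-off w i a (λ e → ne (cong suc e))

sumF-single : ∀ {k} (w : Fin k) a → sumF (single w a) ≡ a
sumF-single {suc k} zero    a = trans (cong (a +_) (sumF-0 k)) (+-identityʳ a)
sumF-single {suc k} (suc w) a = sumF-single w a

single-≤ : ∀ {k} (w : Fin k) a (f : Fin k → ℕ) → a ≤ f w → ∀ i → single w a i ≤ f i
single-≤ w a f le i with i ≟ᶠ w
... | yes refl = subst (_≤ f w) (≡-sym (single-at w a)) le
... | no ne    = subst (_≤ f i) (≡-sym (single-off w i a ne)) z≤n

ind : Bool → ℕ
ind b = if b then 1 else 0

countF≡sumF : ∀ {k} (p : Fin k → Bool) → countF p ≡ sumF (λ i → ind (p i))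
countF≡sumF {zero}  p = refl
countF≡sumF {suc k} p = cong (ind (p zero) +_) (countF≡sumF (p ∘ suc))

countF⇒∃ : ∀ {k} (p : Fin k → Bool) → 1 ≤ countF p → ∃ λ i → p i ≡ true
countF⇒∃ {suc k} p le with p zero in eq
... | true  = zero , eq
... | false with countF⇒∃ (p ∘ suc) le
...   | i , e = suc i , e

_∖_ : ∀ {k} → (Fin k → Bool) → Fin k → Fin k → Bool
(p ∖ i) x = p x ∧ not ⌊ x ≟ᶠ i ⌋

∖⁻ : ∀ {k} (p : Fin k → Bool) i x → (p ∖ i) x ≡ true → p x ≡ true × x ≢ i
∖⁻ p i x e with p x | x ≟ᶠ i
∖⁻ p i x e | true | no ne = refl , ne

∖⁺ : ∀ {k} (p : Fin k → Bool) i x → p x ≡ true → x ≢ i → (p ∖ i) x ≡ true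
∖⁺ p i x e ne with p x | x ≟ᶠ i
∖⁺ p i x e ne | true | yes eq = contradiction eq ne
∖⁺ p i x e ne | true | no _   = refl

-- The indicator of `p` is the point mass at `i` plus the indicator of the rest. The counting lemmas
-- that follow all rest on this splitting.
countF-remove : ∀ {k} (p : Fin k → Bool) i → p i ≡ true → countF p ≡ suc (countF (p ∖ i))
countF-remove p i pi = trans (countF≡sumF p) (trans (sumF-cong pointwise)
  (trans (sumF-+ (single i 1) (λ x → ind ((p ∖ i) x)))
    (cong₂ _+_ (sumF-single i 1) (≡-sym (countF≡sumF (p ∖ i))))))
  where
  pointwise : ∀ x → ind (p x) ≡ single i 1 x + ind ((p ∖ i) x)
  pointwise x with x ≟ᶠ i
  ... | yes refl rewrite pi | single-at i 1 = refl
  ... | no ne rewrite single-off i x 1 ne with p x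
  ...   | true  = refl
  ...   | false = refl

1≤countF : ∀ {k} (p : Fin k → Bool) {i} → p i ≡ true → 1 ≤ countF p
1≤countF p {i} pi = subst (1 ≤_) (≡-sym (countF-remove p i pi)) (s≤s z≤n)

2≤countF : ∀ {k} (p : Fin k → Bool) {i j} → i ≢ j → p i ≡ true → p j ≡ true → 2 ≤ countF p
2≤countF p {i} {j} ne pi pj = subst (2 ≤_) (≡-sym (countF-remove p i pi))
  (s≤s (1≤countF (p ∖ i) (∖⁺ p i j pj (ne ∘ ≡-sym))))

3≤countF : ∀ {k} (p : Fin k → Bool) {i j l} → i ≢ j → i ≢ l → j ≢ l →
  p i ≡ true → p j ≡ true → p l ≡ true → 3 ≤ countF p
3≤countF p {i} {j} {l} i≢j i≢l j≢l pi pj pl = subst (3 ≤_) (≡-sym (countF-remove p i pi))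
  (s≤s (2≤countF (p ∖ i) j≢l (∖⁺ p i j pj (i≢j ∘ ≡-sym)) (∖⁺ p i l pl (i≢l ∘ ≡-sym))))

countF⇒another : ∀ {k} (p : Fin k → Bool) {i} → p i ≡ true → 2 ≤ countF p →
  ∃ λ j → p j ≡ true × j ≢ i
countF⇒another p {i} pi le
  with countF⇒∃ (p ∖ i) (≤-pred (subst (2 ≤_) (countF-remove p i pi) le))
... | j , e = j , ∖⁻ p i j e

countF⇒third : ∀ {k} (p : Fin k → Bool) {i j} → i ≢ j → p i ≡ true → p j ≡ true → 3 ≤ countF p →
  ∃ λ l → p l ≡ true × l ≢ i × l ≢ j
countF⇒third p {i} {j} ne pi pj le
  with countF⇒another (p ∖ i) (∖⁺ p i j pj (ne ∘ ≡-sym))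
         (≤-pred (subst (3 ≤_) (countF-remove p i pi) le))
... | l , e , l≢j = l , proj₁ (∖⁻ p i l e) , proj₂ (∖⁻ p i l e) , l≢j

anyF⁻ : ∀ {k} (p : Fin k → Bool) → anyF p ≡ true → ∃ λ i → p i ≡ true
anyF⁻ {suc k} p e with ∨-true⁻ {p zero} e
... | inj₁ e₀ = zero , e₀
... | inj₂ e₁ with anyF⁻ (p ∘ suc) e₁
...   | i , ei = suc i , ei

anyF⁺ : ∀ {k} (p : Fin k → Bool) i → p i ≡ true → anyF p ≡ true
anyF⁺ p zero    e = ∨-true⁺ˡ (anyF (p ∘ suc)) e
anyF⁺ p (suc i) e = ∨-true⁺ʳ (p zero) (anyF⁺ (p ∘ suc) i e)

≤maxF : ∀ {k} (f : Fin k → ℕ) i → f i ≤ maxF f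
≤maxF f zero    = m≤m⊔n (f zero) _
≤maxF f (suc i) = ≤-trans (≤maxF (f ∘ suc) i) (m≤n⊔m (f zero) _)

maxF-lub : ∀ {k} (f : Fin k → ℕ) {b} → (∀ i → f i ≤ b) → maxF f ≤ b
maxF-lub {zero}  f le = z≤n
maxF-lub {suc k} f le = ⊔-lub (le zero) (maxF-lub (f ∘ suc) (λ i → le (suc i)))

least-unique : ∀ b p k → k ≤ b → (∀ j → j < k → p j ≡ false) → p k ≡ true → least b p ≡ k
least-unique zero    p zero    _        below at = refl
least-unique (suc b) p zero    _        below at rewrite at = refl
least-unique (suc b) p (suc k) (s≤s le) below at rewrite below 0 (s≤s z≤n) =
  cong suc (least-unique b (p ∘ suc) k le (λ j lt → below (suc j) (s≤s lt)) at)

-- Cumulative costs.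

clip : {P : Set} → Dec P → ℕ → ℕ
clip (yes _) a = a
clip (no _)  a = 0

clip-≤ : {P : Set} (d : Dec P) (a : ℕ) → clip d a ≤ a
clip-≤ (yes _) a = ≤-refl
clip-≤ (no _)  a = z≤n

-- The cost accumulated below level `q`. The level `g` is the right end of a block in the upper
-- bound and the spine position in the constructions.
partial : ∀ {k} → (Fin k → ℕ) → (Fin k → ℕ) → ℕ → ℕ
partial g f q = sumF (λ x → clip (g x <? q) (f x))

module _ {k : ℕ} (g f : Fin k → ℕ) where

  partial-0 : partial g f 0 ≡ 0
  partial-0 = n≤0⇒n≡0 (≤-trans (sumF-mono-≤ pointwise) (≤-reflexive (sumF-0 k)))
    where
    pointwise : ∀ x → clip (g x <? 0) (f x) ≤ 0
    pointwise x with g x <? 0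
    ... | no _ = z≤n

  partial-≤sumF : ∀ q → partial g f q ≤ sumF f
  partial-≤sumF q = sumF-mono-≤ (λ x → clip-≤ (g x <? q) (f x))

  sumF≤partial : ∀ {q} → (∀ x → g x < q) → sumF f ≤ partial g f q
  sumF≤partial {q} lt = sumF-mono-≤ pointwise
    where
    pointwise : ∀ x → f x ≤ clip (g x <? q) (f x)
    pointwise x with g x <? q
    ... | yes _ = ≤-refl
    ... | no ¬p = contradiction (lt x) ¬p

  -- The test weight `t` has to dominate `f` only on the levels from `q` to below `r`. It is later
  -- taken to be zero, a point mass, or the indicator of the leaves at one spine vertex.
  partial-upper : ∀ {q r} (t : Fin k → ℕ) → (∀ x → q ≤ g x → g x < r → f x ≤ t x) →
    partial g f r ≤ partial g f q + sumF t
  partial-upper {q} {r} t le = subst (partial g f r ≤_) (sumF-+ (λ x → clip (g x <? q) (f x)) t)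
    (sumF-mono-≤ pointwise)
    where
    pointwise : ∀ x → clip (g x <? r) (f x) ≤ clip (g x <? q) (f x) + t x
    pointwise x with g x <? r | g x <? q
    ... | no _   | _     = z≤n
    ... | yes _  | yes _ = m≤m+n (f x) (t x)
    ... | yes lt | no ¬p = le x (≮⇒≥ ¬p) lt

  partial-lower : ∀ {q r} (t : Fin k → ℕ) → q ≤ r →
    (∀ x → t x ≡ 0 ⊎ (q ≤ g x × g x < r × t x ≤ f x)) →
    partial g f q + sumF t ≤ partial g f r
  partial-lower {q} {r} t q≤r h = subst (_≤ partial g f r) (sumF-+ (λ x → clip (g x <? q) (f x)) t)
    (sumF-mono-≤ pointwise)
    where
    pointwise : ∀ x → clip (g x <? q) (f x) + t x ≤ clip (g x <? r) (f x)
    pointwise x with g x <? q | g x <? r | h x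
    ... | yes lt | no ¬p | _ = contradiction (≤-trans lt q≤r) ¬p
    ... | no _   | no _  | inj₁ e = ≤-reflexive e
    ... | no _   | yes _ | inj₁ e = subst (_≤ f x) (≡-sym e) z≤n
    ... | yes _  | yes _ | inj₁ e = ≤-reflexive (trans (cong (f x +_) e) (+-identityʳ (f x)))
    ... | yes lt | yes _ | inj₂ (q≤ , _ , _) = contradiction lt (≤⇒≯ q≤)
    ... | no _   | yes _ | inj₂ (_ , _ , le) = le
    ... | no _   | no ¬p | inj₂ (_ , lt , _) = contradiction lt ¬p

  partial-single : ∀ {q r} (w : Fin k) a → q ≤ g w → g w < r → a ≤ f w →
    partial g f q + a ≤ partial g f r
  partial-single {q} {r} w a q≤ lt le =
    subst (λ z → partial g f q + z ≤ partial g f r) (sumF-single w a)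
      (partial-lower (single w a) (≤-trans q≤ (<⇒≤ lt)) pointwise)
    where
    pointwise : ∀ x → single w a x ≡ 0 ⊎ (q ≤ g x × g x < r × single w a x ≤ f x)
    pointwise x with x ≟ᶠ w
    ... | yes refl = inj₂ (q≤ , lt , single-≤ w a f le w)
    ... | no ne    = inj₁ (single-off w x a ne)

-- Walks in a graph, and the spine coordinates of a caterpillar.

module _ (G : Graph) where

  adj-sym : ∀ {u w} → Adj G u w → Adj G w u
  adj-sym {u} {w} a = trans (Graph.sym G w u) a

  adj⇒≢ : ∀ {u w} → Adj G u w → u ≢ w
  adj⇒≢ {u} a refl = true≢false a (irrefl G u)

  reach-suc : ∀ k {u v} → reach G k u v ≡ true → reach G (suc k) u v ≡ true
  reach-suc k e = ∨-true⁺ˡ _ e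

  reach-cons : ∀ k {u w v} → Adj G u w → reach G k w v ≡ true → reach G (suc k) u v ≡ true
  reach-cons k {u} {w} {v} a e =
    ∨-true⁺ʳ (reach G k u v) (anyF⁺ (λ x → adj G u x ∧ reach G k x v) w (∧-true⁺ a e))

  reach-uncons : ∀ k {u v} → reach G (suc k) u v ≡ true →
    reach G k u v ≡ true ⊎ (∃ λ w → Adj G u w × reach G k w v ≡ true)
  reach-uncons k {u} {v} e with ∨-true⁻ {reach G k u v} e
  ... | inj₁ e₁ = inj₁ e₁
  ... | inj₂ e₂ with anyF⁻ (λ x → adj G u x ∧ reach G k x v) e₂
  ...   | w , ew = inj₂ (w , ∧-true⁻ ew)

  reach-refl : ∀ u → reach G 0 u u ≡ true
  reach-refl u = isYes⁺ {d = u ≟ᶠ u} refl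

  -- `reach` lengthens a walk at its first vertex; walks along the spine and out to a leaf are
  -- lengthened at the last one.
  reach-snoc : ∀ k {u w v} → reach G k u w ≡ true → Adj G w v → reach G (suc k) u v ≡ true
  reach-snoc zero {u} {w} {v} e a with isYes⁻ {d = u ≟ᶠ w} e
  ... | refl = reach-cons 0 a (reach-refl v)
  reach-snoc (suc k) e a with reach-uncons k e
  ... | inj₁ e₁            = reach-suc (suc k) (reach-snoc k e₁ a)
  ... | inj₂ (x , ax , e₂) = reach-cons (suc k) ax (reach-snoc k e₂ a)

  nonleaf⇒2≤deg : ∀ {u w} → isLeaf G u ≡ false → Adj G u w → 2 ≤ deg G u
  nonleaf⇒2≤deg {u} nl a = ≤∧≢⇒< (1≤countF (adj G u) a)
    (λ e → isYes-no {d = deg G u ≟ 1} nl (≡-sym e))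

-- In the paper's notation s j is v_{j+1} and m = d - 2. Every leaf x hangs off s (pos x), and e₀ and
-- e₁ are leaves at the two ends, in the roles of v_0 and v_d. Indices above m carry no information.
record Spine (G : Graph) : Set where
  field
    m : ℕ
    s : ℕ → Vertex G
    pos : Vertex G → ℕ
    pos≤m : ∀ x → pos x ≤ m
    pos-s : ∀ {j} → j ≤ m → pos (s j) ≡ j
    s-nonleaf : ∀ j → isLeaf G (s j) ≡ false
    s-pos : ∀ x → isLeaf G x ≡ false → s (pos x) ≡ x
    leaf-adj : ∀ x → isLeaf G x ≡ true → Adj G x (s (pos x))
    leaf-unique : ∀ x y → isLeaf G x ≡ true → Adj G x y → y ≡ s (pos x)
    s-step : ∀ {i j} → i ≤ m → j ≤ m → Adj G (s i) (s j) → j ≡ suc i ⊎ i ≡ suc j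
    s-adj : ∀ {i} → suc i ≤ m → Adj G (s i) (s (suc i))
    e₀ e₁ : Vertex G
    leaf-e₀ : isLeaf G e₀ ≡ true
    leaf-e₁ : isLeaf G e₁ ≡ true
    pos-e₀ : pos e₀ ≡ 0
    pos-e₁ : pos e₁ ≡ m
    e₀≢e₁ : e₀ ≢ e₁

-- Distances in spine coordinates.

∣1+n-n∣≡1 : ∀ k → ∣ suc k - k ∣ ≡ 1
∣1+n-n∣≡1 zero    = refl
∣1+n-n∣≡1 (suc k) = ∣1+n-n∣≡1 k

∣n-1+n∣≡1 : ∀ k → ∣ k - suc k ∣ ≡ 1
∣n-1+n∣≡1 zero    = refl
∣n-1+n∣≡1 (suc k) = ∣n-1+n∣≡1 k

module SpineDistance (G : Graph) (S : Spine G) where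
  open Spine S public

  Leaf : Vertex G → Set
  Leaf x = isLeaf G x ≡ true

  NonLeaf : Vertex G → Set
  NonLeaf x = isLeaf G x ≡ false

  -- The height over the spine, that is, the distance from `x` to `s (pos x)`.
  h : Vertex G → ℕ
  h x = ind (isLeaf G x)

  kind : ∀ x → (Leaf x × h x ≡ 1) ⊎ (NonLeaf x × h x ≡ 0)
  kind x with isLeaf G x
  ... | true  = inj₁ (refl , refl)
  ... | false = inj₂ (refl , refl)

  leaf⇒h≡1 : ∀ {x} → Leaf x → h x ≡ 1
  leaf⇒h≡1 l = cong ind l

  nonleaf⇒h≡0 : ∀ {x} → NonLeaf x → h x ≡ 0
  nonleaf⇒h≡0 l = cong ind l

  h≤1 : ∀ x → h x ≤ 1
  h≤1 x with kind x
  ... | inj₁ (_ , e) = ≤-reflexive e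
  ... | inj₂ (_ , e) = ≤-trans (≤-reflexive e) z≤n

  h-s : ∀ j → h (s j) ≡ 0
  h-s j = nonleaf⇒h≡0 (s-nonleaf j)

  leaf≢s : ∀ {x} j → Leaf x → x ≢ s j
  leaf≢s j l refl = true≢false l (s-nonleaf j)

  s-injective : ∀ {i j} → i ≤ m → j ≤ m → s i ≡ s j → i ≡ j
  s-injective i≤ j≤ e = trans (≡-sym (pos-s i≤)) (trans (cong pos e) (pos-s j≤))

  adj-kind : ∀ {x y} → Adj G x y →
    (h x ≡ 1 × h y ≡ 0 × pos x ≡ pos y) ⊎ (h x ≡ 0 × h y ≡ 1 × pos x ≡ pos y) ⊎
    (h x ≡ 0 × h y ≡ 0 × ∣ pos x - pos y ∣ ≡ 1)
  adj-kind {x} {y} a with kind x | kind y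
  ... | inj₁ (lx , hx) | _ with leaf-unique x y lx a
  ...   | refl = inj₁ (hx , h-s _ , ≡-sym (pos-s (pos≤m x)))
  adj-kind {x} {y} a | inj₂ (nx , hx) | inj₁ (ly , hy) with leaf-unique y x ly (adj-sym G a)
  ... | refl = inj₂ (inj₁ (hx , hy , pos-s (pos≤m y)))
  adj-kind {x} {y} a | inj₂ (nx , hx) | inj₂ (ny , hy)
    with s-step (pos≤m x) (pos≤m y) (subst₂ (Adj G) (≡-sym (s-pos x nx)) (≡-sym (s-pos y ny)) a)
  ... | inj₁ e = inj₂ (inj₂ (hx , hy , trans (cong (∣ pos x -_∣) e) (∣n-1+n∣≡1 (pos x))))
  ... | inj₂ e = inj₂ (inj₂ (hx , hy , trans (cong (∣_- pos y ∣) e) (∣1+n-n∣≡1 (pos y))))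

  -- The distance between distinct vertices. On the diagonal it is wrong at leaves, where it gives
  -- 2, so equal vertices are treated separately below.
  δ : Vertex G → Vertex G → ℕ
  δ u v = ∣ pos u - pos v ∣ + (h u + h v)

  -- An edge changes either one height or one position, and by exactly 1. Hence no walk is shorter
  -- than `δ`.
  δ-lipschitz : ∀ {u w} v → Adj G u w → δ u v ≤ suc (δ w v)
  δ-lipschitz {u} {w} v a with adj-kind a
  ... | inj₁ (hu , hw , e) rewrite hu | hw | e = ≤-reflexive (+-suc _ _)
  ... | inj₂ (inj₁ (hu , hw , e)) rewrite hu | hw | e =
    ≤-trans (n≤1+n _) (s≤s (+-monoʳ-≤ ∣ pos w - pos v ∣ (n≤1+n (h v))))
  ... | inj₂ (inj₂ (hu , hw , e)) rewrite hu | hw = +-monoˡ-≤ (h v)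
    (≤-trans (∣-∣-triangle (pos u) (pos w) (pos v)) (≤-reflexive (cong (_+ ∣ pos w - pos v ∣) e)))

  δ-adj : ∀ {u v} → Adj G u v → δ u v ≡ 1
  δ-adj {u} {v} a with adj-kind a
  ... | inj₁ (hu , hw , e) rewrite hu | hw | e = cong (_+ 1) (∣n-n∣≡0 (pos v))
  ... | inj₂ (inj₁ (hu , hw , e)) rewrite hu | hw | e = cong (_+ 1) (∣n-n∣≡0 (pos v))
  ... | inj₂ (inj₂ (hu , hw , e)) rewrite hu | hw = trans (+-identityʳ _) e

  reach⇒δ≤ : ∀ k {u v} → reach G k u v ≡ true → u ≡ v ⊎ δ u v ≤ k
  reach⇒δ≤ zero {u} {v} e = inj₁ (isYes⁻ {d = u ≟ᶠ v} e)
  reach⇒δ≤ (suc k) {u} {v} e with reach-uncons G k e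
  ... | inj₁ e₁ = map₂ m≤n⇒m≤1+n (reach⇒δ≤ k e₁)
  ... | inj₂ (w , a , e₂) with reach⇒δ≤ k e₂
  ...   | inj₁ refl = inj₂ (≤-trans (≤-reflexive (δ-adj a)) (s≤s z≤n))
  ...   | inj₂ le   = inj₂ (≤-trans (δ-lipschitz v a) (s≤s le))

  reach-up : ∀ t j → j + t ≤ m → reach G t (s j) (s (j + t)) ≡ true
  reach-up zero    j le = subst (λ z → reach G 0 (s j) (s z) ≡ true) (≡-sym (+-identityʳ j))
    (reach-refl G (s j))
  reach-up (suc t) j le rewrite +-suc j t =
    reach-snoc G t (reach-up t j (<⇒≤ le)) (s-adj le)

  reach-down : ∀ t j → j + t ≤ m → reach G t (s (j + t)) (s j) ≡ true
  reach-down zero    j le = subst (λ z → reach G 0 (s z) (s j) ≡ true) (≡-sym (+-identityʳ j))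
    (reach-refl G (s j))
  reach-down (suc t) j le rewrite +-suc j t =
    reach-cons G t (adj-sym G (s-adj le)) (reach-down t j (<⇒≤ le))

  reach-spine : ∀ {i j} → i ≤ m → j ≤ m → reach G ∣ i - j ∣ (s i) (s j) ≡ true
  reach-spine {i} {j} i≤ j≤ with ≤-total i j
  ... | inj₁ le = subst (λ z → reach G z (s i) (s j) ≡ true) (≡-sym (m≤n⇒∣m-n∣≡n∸m le))
    (subst (λ z → reach G (j ∸ i) (s i) (s z) ≡ true) (m+[n∸m]≡n le)
      (reach-up (j ∸ i) i (subst (_≤ m) (≡-sym (m+[n∸m]≡n le)) j≤)))
  ... | inj₂ le = subst (λ z → reach G z (s i) (s j) ≡ true) (≡-sym (m≤n⇒∣n-m∣≡n∸m le))
    (subst (λ z → reach G (i ∸ j) (s z) (s j) ≡ true) (m+[n∸m]≡n le)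
      (reach-down (i ∸ j) j (subst (_≤ m) (≡-sym (m+[n∸m]≡n le)) i≤)))

  reach-from-s : ∀ {i} v → i ≤ m → reach G (∣ i - pos v ∣ + h v) (s i) v ≡ true
  reach-from-s {i} v i≤ with kind v
  ... | inj₁ (lv , hv) rewrite hv | +-comm ∣ i - pos v ∣ 1 =
    reach-snoc G ∣ i - pos v ∣ (reach-spine i≤ (pos≤m v)) (adj-sym G (leaf-adj v lv))
  ... | inj₂ (nv , hv) rewrite hv | +-identityʳ ∣ i - pos v ∣ =
    subst (λ z → reach G ∣ i - pos v ∣ (s i) z ≡ true) (s-pos v nv) (reach-spine i≤ (pos≤m v))

  reach-δ : ∀ u v → reach G (δ u v) u v ≡ true
  reach-δ u v with kind u
  ... | inj₁ (lu , hu) rewrite hu | +-suc ∣ pos u - pos v ∣ (h v) =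
    reach-cons G (∣ pos u - pos v ∣ + h v) (leaf-adj u lu) (reach-from-s v (pos≤m u))
  ... | inj₂ (nu , hu) rewrite hu =
    subst (λ z → reach G (∣ pos u - pos v ∣ + h v) z v ≡ true) (s-pos u nu) (reach-from-s v (pos≤m u))

  ∣-∣≤ : ∀ {a b c} → a ≤ c → b ≤ c → ∣ a - b ∣ ≤ c
  ∣-∣≤ {a} {b} a≤ b≤ = ≤-trans (∣m-n∣≤m⊔n a b) (⊔-lub a≤ b≤)

  δ≤m+2 : ∀ u v → δ u v ≤ m + 2
  δ≤m+2 u v = +-mono-≤ (∣-∣≤ (pos≤m u) (pos≤m v)) (+-mono-≤ (h≤1 u) (h≤1 v))

  -- `dist` searches only below `n G`, so every value of `δ` has to fit under this bound. The
  -- `m + 1` spine vertices together with `e₀` are distinct and provide the room.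
  m+2≤n : m + 2 ≤ n G
  m+2≤n = subst (_≤ n G) (+-comm 2 m) (injective⇒≤ {f = emb} emb-injective)
    where
    emb : Fin (2 + m) → Vertex G
    emb zero    = e₀
    emb (suc i) = s (toℕ i)
    bound : (i : Fin (suc m)) → toℕ i ≤ m
    bound i = ≤-pred (toℕ<n i)
    emb-injective : ∀ {i j} → emb i ≡ emb j → i ≡ j
    emb-injective {zero}  {zero}  e = refl
    emb-injective {zero}  {suc j} e = ⊥-elim (leaf≢s _ leaf-e₀ e)
    emb-injective {suc i} {zero}  e = ⊥-elim (leaf≢s _ leaf-e₀ (≡-sym e))
    emb-injective {suc i} {suc j} e = cong suc (toℕ-injective (s-injective (bound i) (bound j) e))

  dist-same : ∀ u → dist G u u ≡ 0
  dist-same u = least-unique (n G) (λ k → reach G k u u) 0 z≤n (λ _ ()) (reach-refl G u)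

  dist-diff : ∀ {u v} → u ≢ v → dist G u v ≡ δ u v
  dist-diff {u} {v} ne = least-unique (n G) (λ k → reach G k u v) (δ u v)
    (≤-trans (δ≤m+2 u v) m+2≤n) below (reach-δ u v)
    where
    below : ∀ j → j < δ u v → reach G j u v ≡ false
    below j lt = ¬true⇒false λ e → [ ne , (λ le → <⇒≱ lt le) ]′ (reach⇒δ≤ j e)

  dist≤δ : ∀ u v → dist G u v ≤ δ u v
  dist≤δ u v with u ≟ᶠ v
  ... | yes refl = subst (_≤ δ u u) (≡-sym (dist-same u)) z≤n
  ... | no ne    = ≤-reflexive (dist-diff ne)

  dist≤m+2 : ∀ u v → dist G u v ≤ m + 2
  dist≤m+2 u v = ≤-trans (dist≤δ u v) (δ≤m+2 u v)

  dist-e₀ : ∀ {x} → x ≢ e₀ → dist G e₀ x ≡ pos x + (1 + h x)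
  dist-e₀ {x} ne = trans (dist-diff (ne ∘ ≡-sym))
    (cong₂ _+_ (cong (∣_- pos x ∣) pos-e₀) (cong (_+ h x) (leaf⇒h≡1 leaf-e₀)))

  dist-e₀-e₁ : dist G e₀ e₁ ≡ m + 2
  dist-e₀-e₁ = trans (dist-e₀ (e₀≢e₁ ∘ ≡-sym)) (cong₂ (λ a b → a + (1 + b)) pos-e₁ (leaf⇒h≡1 leaf-e₁))

  diam≡m+2 : diam G ≡ m + 2
  diam≡m+2 = ≤-antisym (maxF-lub (ecc G) (λ u → maxF-lub (dist G u) (dist≤m+2 u)))
    (subst (_≤ diam G) dist-e₀-e₁ (≤-trans (≤maxF (dist G e₀) e₁) (≤maxF (ecc G) e₀)))

  -- The distance from `x` to `s j` for `j ≤ m`. Distances of two vertices are compared by routing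
  -- both through a common `s j`.
  K : Vertex G → ℕ → ℕ
  K x j = ∣ pos x - j ∣ + h x

  dist-s : ∀ x {j} → j ≤ m → dist G x (s j) ≡ K x j
  dist-s x {j} j≤ with x ≟ᶠ s j
  ... | yes refl rewrite dist-same (s j) | pos-s j≤ | ∣n-n∣≡0 j | h-s j = refl
  ... | no ne rewrite dist-diff ne | pos-s j≤ | h-s j | +-identityʳ (h x) = refl

  K-sum : ∀ u v j → (∣ pos u - j ∣ + ∣ pos v - j ∣) + (h u + h v) ≡ K u j + K v j
  K-sum u v j = +-interchange ∣ pos u - j ∣ ∣ pos v - j ∣ (h u) (h v)

  dist≤K+K : ∀ u v j → dist G u v ≤ K u j + K v j
  dist≤K+K u v j = ≤-trans (dist≤δ u v) (≤-trans
    (+-monoˡ-≤ (h u + h v) (≤-trans (∣-∣-triangle (pos u) j (pos v))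
      (≤-reflexive (cong (∣ pos u - j ∣ +_) (∣-∣-comm j (pos v))))))
    (≤-reflexive (K-sum u v j)))

-- Coordinates for a caterpillar.

module CaterpillarCoordinates (G : Graph) (m : ℕ) (w : Fin (suc m) → Vertex G)
  (connected : Connected G)
  (3≤n : 3 ≤ n G)
  (w-injective : ∀ i j → w i ≡ w j → i ≡ j)
  (w-onto : ∀ u → isLeaf G u ≡ false → Σ (Fin (suc m)) λ i → w i ≡ u)
  (w-nonleaf : ∀ i → isLeaf G (w i) ≡ false)
  (w-path : ∀ i j → (Adj G (w i) (w j) → (toℕ j ≡ suc (toℕ i) ⊎ toℕ i ≡ suc (toℕ j)))
                  × ((toℕ j ≡ suc (toℕ i) ⊎ toℕ i ≡ suc (toℕ j)) → Adj G (w i) (w j))) where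

  clamp : ℕ → Fin (suc m)
  clamp j = fromℕ< (s≤s (m⊓n≤n j m))

  toℕ-clamp : ∀ {j} → j ≤ m → toℕ (clamp j) ≡ j
  toℕ-clamp {j} j≤ = trans (toℕ-fromℕ< (s≤s (m⊓n≤n j m))) (m≤n⇒m⊓n≡m j≤)

  clamp-toℕ : ∀ i → clamp (toℕ i) ≡ i
  clamp-toℕ i = toℕ-injective (toℕ-clamp (≤-pred (toℕ<n i)))

  s : ℕ → Vertex G
  s j = w (clamp j)

  neighbour-unique : ∀ {x y z} → isLeaf G x ≡ true → Adj G x y → Adj G x z → y ≡ z
  neighbour-unique {x} {y} {z} l ay az with y ≟ᶠ z
  ... | yes e = e
  ... | no ne = contradiction
    (subst (2 ≤_) (isYes⁻ {d = deg G x ≟ 1} l) (2≤countF (adj G x) ne ay az)) λ { (s≤s ()) }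

  -- Each of two adjacent leaves has the other as its only neighbour, so no walk leaves the pair.
  -- Connectedness and the existence of a nonleaf then exclude such pairs.
  leaf-pair-closed : ∀ {x y t} → isLeaf G x ≡ true → isLeaf G y ≡ true → Adj G x y →
    ∀ k {z} → z ≡ x ⊎ z ≡ y → reach G k z t ≡ true → t ≡ x ⊎ t ≡ y
  leaf-pair-closed {x} {y} {t} lx ly a zero {z} z∈ e with isYes⁻ {d = z ≟ᶠ t} e
  ... | refl = z∈
  leaf-pair-closed lx ly a (suc k) z∈ e with reach-uncons G k e
  ... | inj₁ e₁ = leaf-pair-closed lx ly a k z∈ e₁
  leaf-pair-closed lx ly a (suc k) (inj₁ refl) e | inj₂ (u , au , e₂) =
    leaf-pair-closed lx ly a k (inj₂ (neighbour-unique lx au a)) e₂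
  leaf-pair-closed lx ly a (suc k) (inj₂ refl) e | inj₂ (u , au , e₂) =
    leaf-pair-closed lx ly a k (inj₁ (neighbour-unique ly au (adj-sym G a))) e₂

  leaf-neighbour-nonleaf : ∀ {x y} → isLeaf G x ≡ true → Adj G x y → isLeaf G y ≡ false
  leaf-neighbour-nonleaf {x} {y} lx a = ¬true⇒false λ ly → case connected x (w zero) of λ
    { (k , e) → case leaf-pair-closed lx ly a k (inj₁ refl) e of λ
      { (inj₁ e₁) → true≢false (trans (cong (isLeaf G) e₁) lx) (w-nonleaf zero)
      ; (inj₂ e₂) → true≢false (trans (cong (isLeaf G) e₂) ly) (w-nonleaf zero) } }

  -- A nonleaf is its own anchor; the anchor of a leaf is its only neighbour, which is not a leaf
  -- and hence lies on the path. Both cases share one index so that `pos` is a single function.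
  anchor : ∀ x → Σ (Fin (suc m)) λ i →
    (isLeaf G x ≡ false → w i ≡ x) × (isLeaf G x ≡ true → Adj G x (w i))
  anchor x with isLeaf G x in eq
  ... | false with w-onto x eq
  ...   | i , e = i , (λ _ → e) , λ ()
  anchor x | true with countF⇒∃ (adj G x) (≤-reflexive (≡-sym (isYes⁻ {d = deg G x ≟ 1} eq)))
  ... | y , a with w-onto y (leaf-neighbour-nonleaf eq a)
  ...   | i , refl = i , (λ ()) , λ _ → a

  pos : Vertex G → ℕ
  pos x = toℕ (proj₁ (anchor x))

  pos≤m : ∀ x → pos x ≤ m
  pos≤m x = ≤-pred (toℕ<n (proj₁ (anchor x)))

  s-pos≡w : ∀ x → s (pos x) ≡ w (proj₁ (anchor x))
  s-pos≡w x = cong w (clamp-toℕ (proj₁ (anchor x)))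

  pos-s : ∀ {j} → j ≤ m → pos (s j) ≡ j
  pos-s {j} j≤ = trans (cong toℕ (w-injective _ _ (proj₁ (proj₂ (anchor (s j))) (w-nonleaf (clamp j)))))
    (toℕ-clamp j≤)

  s-pos : ∀ x → isLeaf G x ≡ false → s (pos x) ≡ x
  s-pos x nl = trans (s-pos≡w x) (proj₁ (proj₂ (anchor x)) nl)

  leaf-adj : ∀ x → isLeaf G x ≡ true → Adj G x (s (pos x))
  leaf-adj x l = subst (Adj G x) (≡-sym (s-pos≡w x)) (proj₂ (proj₂ (anchor x)) l)

  leaf-unique : ∀ x y → isLeaf G x ≡ true → Adj G x y → y ≡ s (pos x)
  leaf-unique x y l a = neighbour-unique l a (leaf-adj x l)

  s-step : ∀ {i j} → i ≤ m → j ≤ m → Adj G (s i) (s j) → j ≡ suc i ⊎ i ≡ suc j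
  s-step {i} {j} i≤ j≤ a = subst₂ (λ p q → q ≡ suc p ⊎ p ≡ suc q) (toℕ-clamp i≤) (toℕ-clamp j≤)
    (proj₁ (w-path (clamp i) (clamp j)) a)

  s-adj : ∀ {i} → suc i ≤ m → Adj G (s i) (s (suc i))
  s-adj {i} i< = proj₂ (w-path (clamp i) (clamp (suc i)))
    (inj₁ (trans (toℕ-clamp i<) (cong suc (≡-sym (toℕ-clamp (<⇒≤ i<))))))

  leaf-pos : ∀ {x j} → isLeaf G x ≡ true → j ≤ m → Adj G (s j) x → pos x ≡ j
  leaf-pos {x} {j} l j≤ a = trans (≡-sym (pos-s (pos≤m x)))
    (trans (cong pos (≡-sym (leaf-unique x (s j) l (adj-sym G a)))) (pos-s j≤))

  nonleaf-neighbour : ∀ {x j} → isLeaf G x ≡ false → j ≤ m → Adj G (s j) x →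
    pos x ≡ suc j ⊎ j ≡ suc (pos x)
  nonleaf-neighbour {x} {j} nl j≤ a = s-step j≤ (pos≤m x) (subst (Adj G (s j)) (≡-sym (s-pos x nl)) a)

  EndLeaves : Set
  EndLeaves = Σ (Vertex G) λ x → Σ (Vertex G) λ y →
    isLeaf G x ≡ true × isLeaf G y ≡ true × pos x ≡ 0 × pos y ≡ m × x ≢ y

  other-vertex : ∀ u → ∃ λ x → x ≢ u
  other-vertex u = pick (n G) 3≤n u
    where
    pick : ∀ k → 3 ≤ k → (u : Fin k) → ∃ λ x → x ≢ u
    pick (suc (suc k)) _         zero    = suc zero , λ ()
    pick (suc (suc k)) _         (suc u) = zero , λ ()
    pick (suc zero)    (s≤s ())  _

  -- The star: every vertex except `s 0` is a leaf, and `s 0` has at least two neighbours.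
  end-leaves-point : m ≡ 0 → EndLeaves
  end-leaves-point m≡0 with other-vertex (s 0)
  ... | x , x≢s = x , y , lx , leaf y (adj⇒≢ G ay ∘ ≡-sym) , pos≡0 x , trans (pos≡0 y) (≡-sym m≡0) , y≢x ∘
      ≡-sym
    where
    pos≡0 : ∀ z → pos z ≡ 0
    pos≡0 z = n≤0⇒n≡0 (subst (pos z ≤_) m≡0 (pos≤m z))
    leaf : ∀ z → z ≢ s 0 → isLeaf G z ≡ true
    leaf z ne with isLeaf G z in eq
    ... | true  = refl
    ... | false = contradiction (trans (≡-sym (s-pos z eq)) (cong s (pos≡0 z))) ne
    lx = leaf x x≢s
    ax : Adj G (s 0) x
    ax = adj-sym G (subst (Adj G x ∘ s) (pos≡0 x) (leaf-adj x lx))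
    another = countF⇒another (adj G (s 0)) ax (nonleaf⇒2≤deg G (w-nonleaf _) ax)
    y = proj₁ another
    ay = proj₁ (proj₂ another)
    y≢x = proj₂ (proj₂ another)

  -- An end of the spine is not a leaf, so it has a neighbour besides its spine neighbour `s i`; by
  -- `only` this neighbour is off the spine.
  leaf-beside : ∀ {j i} → j ≤ m → Adj G (s j) (s i) →
    (∀ x → pos x ≡ suc j ⊎ j ≡ suc (pos x) → pos x ≡ i) →
    ∃ λ x → isLeaf G x ≡ true × pos x ≡ j
  leaf-beside {j} {i} j≤ a only
    with countF⇒another (adj G (s j)) a (nonleaf⇒2≤deg G (w-nonleaf _) a)
  ... | x , ax , x≢ with isLeaf G x in eq
  ...   | true  = x , eq , leaf-pos eq j≤ ax
  ...   | false = contradiction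
    (trans (≡-sym (s-pos x eq)) (cong s (only x (nonleaf-neighbour eq j≤ ax)))) x≢

  end-leaves-path : ∀ {k} → m ≡ suc k → EndLeaves
  end-leaves-path {k} m≡ with leaf-beside z≤n (s-adj (subst (1 ≤_) (≡-sym m≡) (s≤s z≤n))) only₀
    | leaf-beside (≤-reflexive (≡-sym m≡)) (adj-sym G (s-adj (≤-reflexive (≡-sym m≡)))) only₁
    where
    only₀ : ∀ x → pos x ≡ 1 ⊎ 0 ≡ suc (pos x) → pos x ≡ 1
    only₀ x (inj₁ e) = e
    only₁ : ∀ x → pos x ≡ suc (suc k) ⊎ suc k ≡ suc (pos x) → pos x ≡ k
    only₁ x (inj₁ e) = contradiction (≤-trans (≤-reflexive (≡-sym e)) (subst (pos x ≤_) m≡ (pos≤m x))) 1+n≰n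
    only₁ x (inj₂ e) = ≡-sym (suc-injective e)
  ... | x , lx , px | y , ly , py = x , y , lx , ly , px , trans py (≡-sym m≡) ,
    λ { refl → contradiction (trans (≡-sym px) py) λ () }

  end-leaves : EndLeaves
  end-leaves = go m refl
    where
    go : ∀ k → m ≡ k → EndLeaves
    go zero    = end-leaves-point
    go (suc k) = end-leaves-path

  spine : Spine G
  spine with end-leaves
  ... | x , y , lx , ly , px , py , x≢y = record
    { m = m ; s = s ; pos = pos ; pos≤m = pos≤m ; pos-s = pos-s
    ; s-nonleaf = λ j → w-nonleaf (clamp j) ; s-pos = s-pos
    ; leaf-adj = leaf-adj ; leaf-unique = leaf-unique ; s-step = s-step ; s-adj = s-adj
    ; e₀ = x ; e₁ = y ; leaf-e₀ = lx ; leaf-e₁ = ly ; pos-e₀ = px ; pos-e₁ = py ; e₀≢e₁ = x≢y }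

caterpillar-spine : (G : Graph) → IsCaterpillar G → Spine G
caterpillar-spine G ((connected , _) , 3≤n , m , w , inj , onto , nonleaf , path) =
  CaterpillarCoordinates.spine G m w connected 3≤n inj onto nonleaf path

-- Reversing the spine and aligning it with a diametrical path.

m∸n≡1+[m∸1+n] : ∀ {m n} → suc n ≤ m → m ∸ n ≡ suc (m ∸ suc n)
m∸n≡1+[m∸1+n] {suc m} {n} (s≤s le) = +-∸-assoc 1 le

∸-step : ∀ {m i j} → i ≤ m → j ≤ m → m ∸ j ≡ suc (m ∸ i) → i ≡ suc j
∸-step {m} {i} {j} i≤ j≤ e = +-cancelˡ-≡ (m ∸ i) i (suc j) (trans (m∸n+n≡m i≤)
  (trans (≡-sym (m∸n+n≡m j≤)) (trans (cong (_+ j) e) (≡-sym (+-suc (m ∸ i) j)))))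

reverse-spine : ∀ {G} → Spine G → Spine G
reverse-spine {G} S = record
  { m = m ; s = λ j → s (m ∸ j) ; pos = λ x → m ∸ pos x
  ; pos≤m = λ x → m∸n≤m m (pos x)
  ; pos-s = λ {j} j≤ → trans (cong (m ∸_) (pos-s (m∸n≤m m j))) (m∸[m∸n]≡n j≤)
  ; s-nonleaf = λ j → s-nonleaf (m ∸ j)
  ; s-pos = λ x nl → trans (back x) (s-pos x nl)
  ; leaf-adj = λ x l → subst (Adj G x) (≡-sym (back x)) (leaf-adj x l)
  ; leaf-unique = λ x y l a → trans (leaf-unique x y l a) (≡-sym (back x))
  ; s-step = step
  ; s-adj = λ {i} i< → adj-sym G (subst (λ z → Adj G (s (m ∸ suc i)) (s z)) (≡-sym (m∸n≡1+[m∸1+n] i<))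
      (s-adj (subst (_≤ m) (m∸n≡1+[m∸1+n] i<) (m∸n≤m m i))))
  ; e₀ = e₁ ; e₁ = e₀ ; leaf-e₀ = leaf-e₁ ; leaf-e₁ = leaf-e₀
  ; pos-e₀ = trans (cong (m ∸_) pos-e₁) (n∸n≡0 m) ; pos-e₁ = cong (m ∸_) pos-e₀
  ; e₀≢e₁ = e₀≢e₁ ∘ ≡-sym }
  where
  open Spine S
  back : ∀ x → s (m ∸ (m ∸ pos x)) ≡ s (pos x)
  back x = cong s (m∸[m∸n]≡n (pos≤m x))
  step : ∀ {i j} → i ≤ m → j ≤ m → Adj G (s (m ∸ i)) (s (m ∸ j)) → j ≡ suc i ⊎ i ≡ suc j
  step {i} {j} i≤ j≤ a with s-step (m∸n≤m m i) (m∸n≤m m j) a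
  ... | inj₁ e = inj₂ (∸-step i≤ j≤ e)
  ... | inj₂ e = inj₁ (∸-step j≤ i≤ e)

module DiametricalPath {G : Graph} (S : Spine G) {d : ℕ} {v : ℕ → Vertex G}
  (diametrical : IsDiametricalPath G d v) where
  open SpineDistance G S

  v-injective : ∀ {i j} → i ≤ m + 2 → j ≤ m + 2 → v i ≡ v j → i ≡ j
  v-injective {i} {j} i≤ j≤ = proj₁ (proj₂ diametrical) i j (cast i≤) (cast j≤)
    where
    cast : ∀ {k} → k ≤ m + 2 → k ≤ d
    cast le = ≤-trans le (≤-reflexive (≡-sym (trans (proj₁ diametrical) diam≡m+2)))

  v-adj : ∀ {i} → i < m + 2 → Adj G (v i) (v (suc i))
  v-adj {i} lt = proj₂ (proj₂ diametrical) i
    (≤-trans lt (≤-reflexive (≡-sym (trans (proj₁ diametrical) diam≡m+2))))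

  ≤m⇒2+≤m+2 : ∀ {i} → i ≤ m → suc (suc i) ≤ m + 2
  ≤m⇒2+≤m+2 {i} le = subst (suc (suc i) ≤_) (+-comm 2 m) (s≤s (s≤s le))

  -- A leaf in the interior of the path would have its two path neighbours coincide, against
  -- injectivity.
  inner-nonleaf : ∀ {i} → i ≤ m → NonLeaf (v (suc i))
  inner-nonleaf {i} i≤ = ¬true⇒false λ l → contradiction
    (v-injective (≤-trans (n≤1+n _) (≤-trans (n≤1+n _) (≤m⇒2+≤m+2 i≤))) (≤m⇒2+≤m+2 i≤)
      (trans (leaf-unique _ _ l (adj-sym G (v-adj (≤-trans (n≤1+n _) (≤m⇒2+≤m+2 i≤)))))
        (≡-sym (leaf-unique _ _ l (v-adj (≤m⇒2+≤m+2 i≤))))))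
    λ ()

  σ : ℕ → ℕ
  σ i = pos (v (suc i))

  s-σ : ∀ {i} → i ≤ m → s (σ i) ≡ v (suc i)
  s-σ {i} i≤ = s-pos (v (suc i)) (inner-nonleaf i≤)

  σ-injective : ∀ {i j} → i ≤ m → j ≤ m → σ i ≡ σ j → i ≡ j
  σ-injective i≤ j≤ e = suc-injective (v-injective
    (≤-trans (n≤1+n _) (≤m⇒2+≤m+2 i≤)) (≤-trans (n≤1+n _) (≤m⇒2+≤m+2 j≤))
    (trans (≡-sym (s-σ i≤)) (trans (cong s e) (s-σ j≤))))

  σ-step : ∀ {i} → suc i ≤ m → σ (suc i) ≡ suc (σ i) ⊎ σ i ≡ suc (σ (suc i))
  σ-step {i} i< = s-step (pos≤m _) (pos≤m _)
    (subst₂ (Adj G) (≡-sym (s-σ (<⇒≤ i<))) (≡-sym (s-σ i<)) (v-adj (≤m⇒2+≤m+2 (<⇒≤ i<))))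

  n≢2+n : ∀ {i : ℕ} → i ≢ suc (suc i)
  n≢2+n ()

  -- Consecutive positions differ by 1, and turning back would repeat a position, so the first step
  -- fixes the direction.
  ascending : σ 1 ≡ suc (σ 0) → ∀ i → suc i ≤ m → σ (suc i) ≡ suc (σ i)
  ascending up zero    _  = up
  ascending up (suc i) i< with σ-step i<
  ... | inj₁ e = e
  ... | inj₂ e = contradiction
    (σ-injective (<⇒≤ (<⇒≤ i<)) i< (suc-injective (trans (≡-sym (ascending up i (<⇒≤ i<))) e))) n≢2+n

  descending : σ 0 ≡ suc (σ 1) → ∀ i → suc i ≤ m → σ i ≡ suc (σ (suc i))
  descending dn zero    _  = dn
  descending dn (suc i) i< with σ-step i<
  ... | inj₂ e = e
  ... | inj₁ e = contradiction
    (σ-injective (<⇒≤ (<⇒≤ i<)) i< (trans (descending dn i (<⇒≤ i<)) (≡-sym e))) n≢2+n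

  ascending-sum : σ 1 ≡ suc (σ 0) → ∀ i → i ≤ m → σ i ≡ i + σ 0
  ascending-sum up zero    _  = refl
  ascending-sum up (suc i) i< = trans (ascending up i i<) (cong suc (ascending-sum up i (<⇒≤ i<)))

  descending-sum : σ 0 ≡ suc (σ 1) → ∀ i → i ≤ m → σ 0 ≡ i + σ i
  descending-sum dn zero    _  = refl
  descending-sum dn (suc i) i< = trans (descending-sum dn i (<⇒≤ i<))
    (trans (cong (i +_) (descending dn i i<)) (+-suc i _))

  -- A monotone run of `m + 1` positions inside `0, ..., m` has no room to be shifted: it starts at
  -- 0 and ascends or starts at `m` and descends.
  orientation : (∀ j → j ≤ m → σ j ≡ j) ⊎ (∀ j → j ≤ m → σ j ≡ m ∸ j)
  orientation with 1 ≤? m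
  ... | no m<1 = inj₁ λ j j≤ → trans (n≤0⇒n≡0 (≤-trans (pos≤m (v (suc j))) m≤0))
      (≡-sym (n≤0⇒n≡0 (≤-trans j≤ m≤0)))
    where
    m≤0 : m ≤ 0
    m≤0 = ≤-pred (≰⇒> m<1)
  ... | yes 1≤m with σ-step 1≤m
  ...   | inj₁ up = inj₁ λ j j≤ → trans (ascending-sum up j j≤) (trans (cong (j +_) σ0≡0) (+-identityʳ j))
    where
    σ0≡0 : σ 0 ≡ 0
    σ0≡0 = n≤0⇒n≡0 (+-cancelˡ-≤ m _ _ (subst₂ _≤_ (ascending-sum up m ≤-refl) (≡-sym (+-identityʳ m))
      (pos≤m (v (suc m)))))
  ...   | inj₂ dn = inj₂ λ j j≤ → ≡-sym (trans (cong (_∸ j) (trans (≡-sym σ0≡m) (descending-sum dn j j≤)))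
      (m+n∸m≡n j (σ j)))
    where
    σ0≡m : σ 0 ≡ m
    σ0≡m = ≤-antisym (pos≤m (v 1)) (subst (m ≤_) (≡-sym (descending-sum dn m ≤-refl)) (m≤m+n m _))

oriented-spine : ∀ {G} → IsCaterpillar G → ∀ {d v} → IsDiametricalPath G d v →
  Σ (Spine G) λ S → ∀ j → j ≤ Spine.m S → v (suc j) ≡ Spine.s S j
oriented-spine {G} cat diametrical with DiametricalPath.orientation (caterpillar-spine G cat) diametrical
... | inj₁ e = caterpillar-spine G cat , λ j j≤ →
  trans (≡-sym (DiametricalPath.s-σ (caterpillar-spine G cat) diametrical j≤))
    (cong (Spine.s (caterpillar-spine G cat)) (e j j≤))
... | inj₂ e = reverse-spine (caterpillar-spine G cat) , λ j j≤ →
  trans (≡-sym (DiametricalPath.s-σ (caterpillar-spine G cat) diametrical j≤))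
    (cong (Spine.s (caterpillar-spine G cat)) (e j j≤))

-- Leaves and degrees along the spine.

module SpineDegrees (G : Graph) (S : Spine G) where
  open SpineDistance G S public

  ℓ : ℕ → ℕ
  ℓ j = leafNeighbours G (s j)

  Heavy : ℕ → Set
  Heavy j = 3 ≤ deg G (s j)

  leafAt : ℕ → Vertex G → Bool
  leafAt j x = adj G (s j) x ∧ isLeaf G x

  leaf-adj-at : ∀ {x j} → Leaf x → pos x ≡ j → Adj G (s j) x
  leaf-adj-at {x} lx refl = adj-sym G (leaf-adj x lx)

  leafAt⁺ : ∀ {x j} → Leaf x → pos x ≡ j → leafAt j x ≡ true
  leafAt⁺ lx e = ∧-true⁺ (leaf-adj-at lx e) lx

  leafAt⁻ : ∀ {x j} → j ≤ m → leafAt j x ≡ true → Leaf x × pos x ≡ j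
  leafAt⁻ {x} {j} j≤ e with ∧-true⁻ {adj G (s j) x} e
  ... | a , lx = lx , s-injective (pos≤m x) j≤ (≡-sym (leaf-unique x (s j) lx (adj-sym G a)))

  one-leaf : ∀ {j} → j ≤ m → 1 ≤ ℓ j → ∃ λ x → Leaf x × pos x ≡ j
  one-leaf {j} j≤ le with countF⇒∃ (leafAt j) le
  ... | x , ex = x , leafAt⁻ j≤ ex

  1≤ℓ : ∀ {x j} → Leaf x → pos x ≡ j → 1 ≤ ℓ j
  1≤ℓ {j = j} lx px = 1≤countF (leafAt j) (leafAt⁺ lx px)

  2≤ℓ : ∀ {x y j} → Leaf x → Leaf y → pos x ≡ j → pos y ≡ j → x ≢ y → 2 ≤ ℓ j
  2≤ℓ {j = j} lx ly px py ne = 2≤countF (leafAt j) ne (leafAt⁺ lx px) (leafAt⁺ ly py)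

  two-leaves : ∀ {j} → j ≤ m → 2 ≤ ℓ j →
    ∃ λ x → ∃ λ y → Leaf x × Leaf y × pos x ≡ j × pos y ≡ j × x ≢ y
  two-leaves {j} j≤ le with countF⇒∃ (leafAt j) (≤-trans (s≤s z≤n) le)
  ... | x , ex with countF⇒another (leafAt j) ex le
  ...   | y , ey , ne = x , y , proj₁ (leafAt⁻ j≤ ex) , proj₁ (leafAt⁻ j≤ ey)
    , proj₂ (leafAt⁻ j≤ ex) , proj₂ (leafAt⁻ j≤ ey) , ne ∘ ≡-sym

  s-adj-down : ∀ {i} → suc i ≤ m → Adj G (s (suc i)) (s i)
  s-adj-down i< = adj-sym G (s-adj i<)

  s≢s : ∀ {i j} → i ≤ m → j ≤ m → i ≢ j → s i ≢ s j
  s≢s i≤ j≤ ne e = ne (s-injective i≤ j≤ e)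

  heavy-inner : ∀ {x j} → 1 ≤ j → j < m → Leaf x → pos x ≡ j → Heavy j
  heavy-inner {x} {suc j} _ j<m lx e = 3≤countF (adj G (s (suc j)))
    (leaf≢s j lx) (leaf≢s (suc (suc j)) lx) (s≢s (<⇒≤ (<⇒≤ j<m)) j<m λ ())
    (leaf-adj-at lx e) (s-adj-down (<⇒≤ j<m)) (s-adj j<m)

  heavy-double : ∀ {x y j} → 1 ≤ m → j ≤ m → Leaf x → Leaf y → pos x ≡ j → pos y ≡ j → x ≢ y → Heavy j
  heavy-double {j = zero} 1≤m _ lx ly ex ey ne = 3≤countF (adj G (s 0))
    ne (leaf≢s 1 lx) (leaf≢s 1 ly) (leaf-adj-at lx ex) (leaf-adj-at ly ey) (s-adj 1≤m)
  heavy-double {j = suc j} _ j≤ lx ly ex ey ne = 3≤countF (adj G (s (suc j)))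
    ne (leaf≢s j lx) (leaf≢s j ly) (leaf-adj-at lx ex) (leaf-adj-at ly ey) (s-adj-down j≤)

  2≤ℓ⇒heavy : ∀ {j} → 1 ≤ m → j ≤ m → 2 ≤ ℓ j → Heavy j
  2≤ℓ⇒heavy 1≤m j≤ le with two-leaves j≤ le
  ... | x , y , lx , ly , px , py , ne = heavy-double 1≤m j≤ lx ly px py ne

  2≤deg : ∀ {j} → j ≤ m → 2 ≤ deg G (s j)
  2≤deg {zero}  _  = nonleaf⇒2≤deg G (s-nonleaf 0) (leaf-adj-at leaf-e₀ pos-e₀)
  2≤deg {suc j} j≤ = nonleaf⇒2≤deg G (s-nonleaf (suc j)) (s-adj-down j≤)

  third-is-leaf : ∀ {j x} → j ≤ m → Adj G (s j) x → (∀ i → i ≤ m → j ≡ suc i → x ≢ s i) →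
    (suc j ≤ m → x ≢ s (suc j)) → Leaf x × pos x ≡ j
  third-is-leaf {j} {x} j≤ a below above with kind x
  ... | inj₁ (lx , _) = leafAt⁻ j≤ (∧-true⁺ a lx)
  ... | inj₂ (nx , _) with s-step j≤ (pos≤m x) (subst (Adj G (s j)) (≡-sym (s-pos x nx)) a)
  ...   | inj₁ e = contradiction (trans (≡-sym (s-pos x nx)) (cong s e))
    (above (subst (_≤ m) e (pos≤m x)))
  ...   | inj₂ e = contradiction (≡-sym (s-pos x nx)) (below (pos x) (pos≤m x) e)

  -- Two neighbours are known: both spine neighbours in the interior, or one spine neighbour and the
  -- end leaf at an end. A third one must be a further leaf, so it differs from `e₀` and `e₁`.
  heavy⇒leaf : ∀ {j} → 1 ≤ m → j ≤ m → Heavy j →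
    ∃ λ x → Leaf x × pos x ≡ j × x ≢ e₀ × x ≢ e₁
  heavy⇒leaf {zero} 1≤m j≤ big
    with countF⇒third (adj G (s 0)) (leaf≢s 1 leaf-e₀) (leaf-adj-at leaf-e₀ pos-e₀) (s-adj 1≤m) big
  ... | x , a , x≢e₀ , x≢s1 with third-is-leaf j≤ a (λ _ _ ()) (λ _ → x≢s1)
  ...   | lx , px = x , lx , px , x≢e₀ , λ { refl → <⇒≢ 1≤m (trans (≡-sym px) pos-e₁) }
  heavy⇒leaf {suc j} 1≤m j≤ big with m≤n⇒m<n∨m≡n j≤
  ... | inj₁ j<m with countF⇒third (adj G (s (suc j))) (s≢s (<⇒≤ (<⇒≤ j<m)) j<m λ ())
                        (s-adj-down j≤) (s-adj j<m) big
  ...   | x , a , x≢s , x≢s′ with third-is-leaf j≤ a (λ { _ _ refl → x≢s }) (λ _ → x≢s′)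
  ...     | lx , px = x , lx , px , (λ { refl → contradiction (trans (≡-sym px) pos-e₀) λ () })
    , λ { refl → <⇒≢ j<m (trans (≡-sym px) pos-e₁) }
  heavy⇒leaf {suc j} 1≤m j≤ big | inj₂ refl
    with countF⇒third (adj G (s (suc j))) (leaf≢s j leaf-e₁ ∘ ≡-sym) (s-adj-down j≤)
      (leaf-adj-at leaf-e₁ pos-e₁) big
  ... | x , a , x≢s , x≢e₁ with third-is-leaf j≤ a (λ { _ _ refl → x≢s }) (λ lt → contradiction lt 1+n≰n)
  ...   | lx , px = x , lx , px , (λ { refl → contradiction (trans (≡-sym px) pos-e₀) λ () }) , x≢e₁

  dist≡0 : ∀ {u v} → dist G u v ≡ 0 → u ≡ v
  dist≡0 {u} {v} e with u ≟ᶠ v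
  ... | yes eq = eq
  ... | no ne = isYes⁻ {d = u ≟ᶠ v}
    (subst (λ k → reach G k u v ≡ true) (trans (≡-sym (dist-diff ne)) e) (reach-δ u v))

-- Minimality and private vertices.

module _ (G : Graph) (f : Vertex G → ℕ) where

  -- `u` is private to `w`. That `w` does dominate `u` is not included; it follows once `f` is
  -- dominating.
  OnlyDominator : Vertex G → Vertex G → Set
  OnlyDominator w u = ∀ x → 1 ≤ f x → dist G x u ≤ f x → x ≡ w

  -- If `f′` is smaller at `w`, only `w` could still dominate the private vertex `u`. The lowered
  -- strength is either less than the distance to `u` or equal to 0.
  private⇒minimal : IsBroadcast G f → Dominating G f →
    (∀ w → 1 ≤ f w → ∃ λ u → OnlyDominator w u × (f w ≤ dist G w u ⊎ f w ≤ 1)) →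
    MinimalDominating G f
  private⇒minimal br dom priv = (br , dom) , λ f′ _ f′≤f ne dom′ →
    case ¬∀⟶∃¬ (n G) (λ v → f′ v ≡ f v) (λ v → f′ v ≟ f v) ne of λ { (w , f′w≢) →
    let f′w<fw = ≤∧≢⇒< (f′≤f w) f′w≢ in
    case priv w (≤-trans (s≤s z≤n) f′w<fw) of λ { (u , only , tight) →
    case dom′ u of λ { (x , 1≤f′x , d≤) →
    case only x (≤-trans 1≤f′x (f′≤f x)) (≤-trans d≤ (f′≤f x)) of λ { refl →
      [ (λ far → <⇒≱ f′w<fw (≤-trans far d≤)) , (λ f≤1 → <⇒≱ f′w<fw (≤-trans f≤1 1≤f′x)) ]′ tight } } } }

module _ (G : Graph) (S : Spine G) where
  open SpineDegrees G S

  -- Lowering `f` by 1 at `w` alone must leave some vertex undominated, and this vertex is private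
  -- to `w`.
  minimal⇒private : ∀ {f} → MinimalDominating G f → ∀ w → 1 ≤ f w → ∃ λ u →
    OnlyDominator G f w u × ((w ≢ u × dist G w u ≡ f w) ⊎ (u ≡ w × f w ≡ 1))
  minimal⇒private {f} ((br , dom) , min) w 1≤fw
    with ¬∀⟶∃¬ (n G) (λ u → Σ (Vertex G) λ v → 1 ≤ f′ v × dist G v u ≤ f′ v)
           (λ u → any? λ v → (1 ≤? f′ v) ×-dec (dist G v u ≤? f′ v))
           (min f′ (λ v → ≤-trans (f′≤f v) (br v)) f′≤f (λ eq → <⇒≢ f′w<fw (eq w)))
    where
    f′ : Vertex G → ℕ
    f′ x = f x ∸ single w 1 x
    f′≤f : ∀ x → f′ x ≤ f x
    f′≤f x = m∸n≤m (f x) (single w 1 x)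
    f′w<fw : f′ w < f w
    f′w<fw rewrite single-at w 1 = ∸-monoʳ-< (s≤s z≤n) 1≤fw
  ... | u , undominated = u , only , tight
    where
    only : OnlyDominator G f w u
    only x 1≤fx d≤ with x ≟ᶠ w
    ... | yes e = e
    ... | no ne = contradiction
      (x , subst (λ z → 1 ≤ f x ∸ z) (≡-sym (single-off w x 1 ne)) 1≤fx
         , subst (λ z → dist G x u ≤ f x ∸ z) (≡-sym (single-off w x 1 ne)) d≤) undominated
    dominated : dist G w u ≤ f w
    dominated with dom u
    ... | x , 1≤fx , d≤ with only x 1≤fx d≤
    ...   | refl = d≤
    far : ∀ a → f w ≡ suc a → 1 ≤ a → ¬ (dist G w u ≤ a)
    far a e 1≤a d≤a = undominated (w
      , subst₂ (λ p q → 1 ≤ p ∸ q) (≡-sym e) (≡-sym (single-at w 1)) 1≤a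
      , subst₂ (λ p q → dist G w u ≤ p ∸ q) (≡-sym e) (≡-sym (single-at w 1)) d≤a)
    tight : (w ≢ u × dist G w u ≡ f w) ⊎ (u ≡ w × f w ≡ 1)
    tight = go (f w) refl (w ≟ᶠ u)
      where
      go : ∀ k → f w ≡ k → Dec (w ≡ u) → (w ≢ u × dist G w u ≡ f w) ⊎ (u ≡ w × f w ≡ 1)
      go zero          e _          = contradiction (subst (1 ≤_) e 1≤fw) λ ()
      go (suc zero)    e (yes refl) = inj₂ (refl , e)
      go (suc zero)    e (no ne)    = inj₁ (ne , ≤-antisym dominated
        (subst (_≤ dist G w u) (≡-sym e) (n≢0⇒n>0 (ne ∘ dist≡0))))
      -- With strength at least 2, `w` still dominates itself after the lowering, so the undominated
      -- vertex is not `w`.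
      go (suc (suc a)) e (yes refl) = contradiction (subst (_≤ suc a) (≡-sym (dist-same w)) z≤n)
        (far (suc a) e (s≤s z≤n))
      go (suc (suc a)) e (no ne)    = inj₁ (ne , ≤-antisym dominated
        (subst (_≤ dist G w u) (≡-sym e) (≰⇒> (far (suc a) e (s≤s z≤n)))))

-- The upper bound: scanning the blocks from left to right.

∣m+n-m∣≡n : ∀ k l → ∣ k + l - k ∣ ≡ l
∣m+n-m∣≡n k l = trans (∣-∣-comm (k + l) k) (∣m-m+n∣≡n k l)

∣-∣-split : ∀ {a b j} → a ≤ j → j ≤ b → ∣ a - b ∣ ≡ ∣ a - j ∣ + ∣ b - j ∣
∣-∣-split {a} a≤j j≤b with m≤n⇒∃[o]m+o≡n a≤j | m≤n⇒∃[o]m+o≡n j≤b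
... | x , refl | y , refl = trans (cong (∣ a -_∣) (+-assoc a x y)) (trans (∣m-m+n∣≡n a (x + y))
  (≡-sym (cong₂ _+_ (∣m-m+n∣≡n a x) (∣m+n-m∣≡n (a + x) y))))

between : ∀ {a b j} → a ⊓ b ≤ j → j ≤ a ⊔ b → ∣ a - b ∣ ≡ ∣ a - j ∣ + ∣ b - j ∣
between {a} {b} {j} lo≤ ≤hi with ≤-total a b
... | inj₁ a≤b = ∣-∣-split (subst (_≤ j) (m≤n⇒m⊓n≡m a≤b) lo≤) (subst (j ≤_) (m≤n⇒m⊔n≡n a≤b) ≤hi)
... | inj₂ b≤a = trans (∣-∣-comm a b) (trans
  (∣-∣-split (subst (_≤ j) (m≥n⇒m⊓n≡n b≤a) lo≤) (subst (j ≤_) (m≥n⇒m⊔n≡m b≤a) ≤hi))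
  (+-comm ∣ b - j ∣ ∣ a - j ∣))

module UpperBound (G : Graph) (S : Spine G) where
  open SpineDegrees G S

  -- The failure of (iii) between `p` and `q`: a spine vertex that is not heavy has degree 2.
  NoLightPair : ℕ → ℕ → Set
  NoLightPair p q = ∀ k → p < k → k < q → ¬ Heavy k → ¬ Heavy (suc k) → ⊥

  -- The first three hypotheses are (i), (ii) and (iii) in spine coordinates; `u` selects a private
  -- vertex for every broadcasting vertex.
  module _
    (atMost2 : ∀ j → j ≤ m → ℓ j ≤ 2)
    (noHeavyPair : ∀ j → suc j ≤ m → Heavy j → Heavy (suc j) → ⊥)
    (lightPair : ∀ p q → p < q → q ≤ m → 2 ≤ ℓ p → 2 ≤ ℓ q → ¬ NoLightPair p q)
    (f : Vertex G → ℕ) (u : Vertex G → Vertex G)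
    (only : ∀ w → 1 ≤ f w → OnlyDominator G f w (u w))
    (tight : ∀ w → 1 ≤ f w → (w ≢ u w × dist G w (u w) ≡ f w) ⊎ (u w ≡ w × f w ≡ 1)) where

    -- The block of `w` is the interval of spine positions between `w` and its private vertex.
    lo hi : Vertex G → ℕ
    lo w = pos w ⊓ pos (u w)
    hi w = pos w ⊔ pos (u w)

    Covers : Vertex G → ℕ → Set
    Covers w j = lo w ≤ j × j ≤ hi w

    lo≤hi : ∀ w → lo w ≤ hi w
    lo≤hi w = m⊓n≤m⊔n (pos w) (pos (u w))

    hi≤m : ∀ w → hi w ≤ m
    hi≤m w = ⊔-lub (pos≤m w) (pos≤m (u w))

    -- The exceptional blocks: several of them may occupy the same position.
    LeafSingle : Vertex G → Set
    LeafSingle w = u w ≡ w × Leaf w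

    leafSingle? : ∀ w → Dec (LeafSingle w)
    leafSingle? w = (u w ≟ᶠ w) ×-dec (isLeaf G w ≟ᵇ true)

    lo-self : ∀ {w} → u w ≡ w → lo w ≡ pos w
    lo-self {w} e = trans (cong (λ z → pos w ⊓ pos z) e) (⊓-idem (pos w))

    hi-self : ∀ {w} → u w ≡ w → hi w ≡ pos w
    hi-self {w} e = trans (cong (λ z → pos w ⊔ pos z) e) (⊔-idem (pos w))

    leafSingle-f : ∀ {w} → 1 ≤ f w → LeafSingle w → f w ≡ 1
    leafSingle-f {w} 1≤fw (e , _) with tight w 1≤fw
    ... | inj₁ (ne , _) = contradiction (≡-sym e) ne
    ... | inj₂ (_ , e₁) = e₁

    f-path : ∀ {w} j → Covers w j → w ≢ u w → dist G w (u w) ≡ f w → f w ≡ K w j + K (u w) j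
    f-path {w} j (lo≤ , ≤hi) ne e = trans (≡-sym e) (trans (dist-diff ne)
      (trans (cong (_+ (h w + h (u w))) (between {pos w} lo≤ ≤hi)) (K-sum w (u w) j)))

    -- On its path `w` spends exactly `K w j + K (u w) j`, and this must fall short of `u x`, which
    -- is at most `K w j + K (u x) j` away; cancelling `K w j` compares the private vertices. Only
    -- for a leaf that is its own private vertex does strictness fail, since its strength is 1 while
    -- the formula would give 2.
    nearer : ∀ {w x} j → 1 ≤ f w → 1 ≤ f x → w ≢ x → Covers w j →
      K (u w) j < K (u x) j ⊎ (LeafSingle w × K (u w) j ≤ K (u x) j)
    nearer {w} {x} j 1≤fw 1≤fx w≢x cov@(lo≤ , ≤hi) with tight w 1≤fw
    ... | inj₁ (ne , e) = inj₁ (+-cancelˡ-< (K w j) (K (u w) j) (K (u x) j)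
      (subst (_< K w j + K (u x) j) (f-path j cov ne e) not-dominated))
      where
      not-dominated : f w < K w j + K (u x) j
      not-dominated = ≤-trans (≰⇒> (w≢x ∘ only x 1≤fx w 1≤fw)) (dist≤K+K w (u x) j)
    ... | inj₂ (e , f≡1) = by-kind (kind w)
      where
      j≡pos : j ≡ pos w
      j≡pos = ≤-antisym (subst (j ≤_) (hi-self e) ≤hi) (subst (_≤ j) (lo-self e) lo≤)
      Kw : K w j ≡ h w
      Kw = cong (_+ h w) (trans (cong (∣ pos w -_∣) j≡pos) (∣n-n∣≡0 (pos w)))
      not-dominated : 1 < h w + K (u x) j
      not-dominated = subst₂ (λ a b → a < b + K (u x) j) f≡1 Kw
        (≤-trans (≰⇒> (w≢x ∘ only x 1≤fx w 1≤fw)) (dist≤K+K w (u x) j))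
      Kuw : K (u w) j ≡ h w
      Kuw = trans (cong (λ z → K z j) e) Kw
      by-kind : (Leaf w × h w ≡ 1) ⊎ (NonLeaf w × h w ≡ 0) →
        K (u w) j < K (u x) j ⊎ (LeafSingle w × K (u w) j ≤ K (u x) j)
      by-kind (inj₁ (lw , hw)) = inj₂ ((e , lw) , subst (_≤ K (u x) j) (≡-sym (trans Kuw hw))
        (≤-pred (subst (λ b → 1 < b + K (u x) j) hw not-dominated)))
      by-kind (inj₂ (_ , hw)) = inj₁ (subst (_< K (u x) j) (≡-sym (trans Kuw hw))
        (<⇒≤ (subst (λ b → 1 < b + K (u x) j) hw not-dominated)))

    -- Two blocks meet only in a group of single leaves: on a common spine vertex s j, the private vertex
    -- of w must be closer to s j than that of x, and conversely.
    overlapping : ∀ {w x} j → 1 ≤ f w → 1 ≤ f x → w ≢ x → Covers w j → Covers x j → LeafSingle w ×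
      LeafSingle x
    overlapping j 1≤fw 1≤fx w≢x cw cx with nearer j 1≤fw 1≤fx w≢x cw | nearer j 1≤fx 1≤fw (w≢x ∘ ≡-sym) cx
    ... | inj₁ lt       | inj₁ gt       = contradiction lt (<-asym gt)
    ... | inj₁ lt       | inj₂ (_ , ge) = contradiction lt (≤⇒≯ ge)
    ... | inj₂ (_ , le) | inj₁ gt       = contradiction gt (≤⇒≯ le)
    ... | inj₂ (lw , _) | inj₂ (lx , _) = lw , lx

    costTo : ℕ → ℕ
    costTo = partial hi f

    -- No block straddles the cut just before position `q`, so `costTo q` charges whole blocks.
    Boundary : ℕ → Set
    Boundary q = ∀ w → 1 ≤ f w → lo w < q → hi w < q

    -- What is known at position l when the blocks up to l have cost l + 2, one more than their number of
    -- positions. spill: a broadcast from the left already reaches s (suc l). heavy and light: since a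
    -- group of two single leaves at p, degrees alternate between at least 3 and 2; in the state light the
    -- last vertex s l broadcasts with strength 1 and is its own private vertex.
    data State (l : ℕ) : Set where
      spill : Heavy l → ∀ z → 1 ≤ f z → hi z ≤ l → K z (suc l) ≤ f z → State l
      heavy : Heavy l → ∀ p → p ≤ l → 2 ≤ ℓ p → NoLightPair p l → State l
      light : ∀ z → z ≡ s l → u z ≡ z → f z ≡ 1 → ∀ p → p < l → 2 ≤ ℓ p → NoLightPair p l → State l

    -- `low` means no surplus over the number of scanned positions; `high` allows a surplus of 1,
    -- with a `State` to restrict what follows as long as positions remain.
    data Inv : ℕ → Set where
      low  : ∀ {q} → costTo q ≤ q → Inv q
      high : ∀ {l} → costTo (suc l) ≤ suc (suc l) → (suc l ≤ m → State l) → Inv (suc l)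

    Inv⇒≤ : ∀ {q} → Inv q → costTo q ≤ suc q
    Inv⇒≤ (low le)    = m≤n⇒m≤1+n le
    Inv⇒≤ (high le _) = le

    no-f : ∀ {w} → ¬ (1 ≤ f w) → f w ≤ 0
    no-f ¬1≤ = ≤-pred (≰⇒> ¬1≤)

    Next : ℕ → Set
    Next q = ∃ λ r → q < r × r ≤ suc m × Boundary r × Inv r

    -- No block starts at `q` or runs through it, so this position costs nothing and absorbs a
    -- surplus.
    uncovered : ∀ {q} → q ≤ m → Boundary q → Inv q → ¬ (∃ λ w → 1 ≤ f w × lo w ≡ q) → Next q
    uncovered {q} q≤m bd inv none = suc q , ≤-refl , s≤s q≤m , boundary , low bound
      where
      starts-before : ∀ w → 1 ≤ f w → lo w < suc q → lo w < q
      starts-before w 1≤fw lt = ≤∧≢⇒< (≤-pred lt) (λ e → none (w , 1≤fw , e))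
      boundary : Boundary (suc q)
      boundary w 1≤fw lt = m≤n⇒m≤1+n (bd w 1≤fw (starts-before w 1≤fw lt))
      nothing : ∀ x → q ≤ hi x → hi x < suc q → f x ≤ 0
      nothing x q≤ lt = no-f λ 1≤fx →
        <⇒≱ (bd x 1≤fx (starts-before x 1≤fx (≤-trans (s≤s (lo≤hi x)) lt))) q≤
      bound : costTo (suc q) ≤ suc q
      bound = ≤-trans (partial-upper hi f (λ _ → 0) nothing)
        (≤-trans (≤-reflexive (trans (cong (costTo q +_) (sumF-0 (n G))) (+-identityʳ (costTo q))))
          (Inv⇒≤ inv))

    dominates-s⇒≡ : ∀ {z w q} → q ≤ m → u w ≡ s q → 1 ≤ f w → 1 ≤ f z → K z q ≤ f z → z ≡ w
    dominates-s⇒≡ {z} {w} {q} q≤m uw 1≤fw 1≤fz Kz = only w 1≤fw z 1≤fz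
      (subst (_≤ f z) (trans (≡-sym (dist-s z q≤m)) (cong (dist G z) (≡-sym uw))) Kz)

    light-K : ∀ {z l} → l ≤ m → z ≡ s l → K z (suc l) ≡ 1
    light-K {l = l} l≤ refl rewrite pos-s l≤ | h-s l = trans (+-identityʳ _) (∣n-1+n∣≡1 l)

    pos-light : ∀ {z l} → l ≤ m → z ≡ s l → pos z ≡ l
    pos-light l≤ refl = pos-s l≤

    K-back : ∀ {w l} t → pos w ≡ suc l + t → K w l ≡ suc t + h w
    K-back {w} {l} t e = cong (_+ h w) (trans (cong (∣_- l ∣) (trans e (≡-sym (+-suc l t))))
      (∣m+n-m∣≡n l (suc t)))

    Spills : ℕ → Set
    Spills l = ∃ λ z → 1 ≤ f z × hi z ≤ l × K z (suc l) ≤ f z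

    light-spills : ∀ {z l} → l ≤ m → z ≡ s l → u z ≡ z → f z ≡ 1 → Spills l
    light-spills {z} l≤ zs uz fz = z , ≤-reflexive (≡-sym fz)
      , ≤-reflexive (trans (hi-self uz) (pos-light l≤ zs))
      , ≤-reflexive (trans (light-K l≤ zs) (≡-sym fz))

    -- `s (suc l)` already hears a broadcast whose block ended earlier, so it cannot be private to a
    -- block that starts there.
    spill-blocks : ∀ {l w} → suc l ≤ m → Spills l → 1 ≤ f w → lo w ≡ suc l → u w ≢ s (suc l)
    spill-blocks {l} {w} l< (z , 1≤fz , hz , Kz) 1≤fw lw uw with dominates-s⇒≡ l< uw 1≤fw 1≤fz Kz
    ... | refl = <⇒≱ (s≤s hz) (subst (_≤ hi w) lw (lo≤hi w))

    -- `s l` is private to `z`, so a block starting at the next position may not reach back to it.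
    light-blocks : ∀ {z l w} → l ≤ m → z ≡ s l → u z ≡ z → f z ≡ 1 → 1 ≤ f w → lo w ≡ suc l → ¬ (K w l ≤ f w)
    light-blocks {z} {l} {w} l≤ zs uz fz 1≤fw lw Kw
      with dominates-s⇒≡ l≤ (trans uz zs) (≤-reflexive (≡-sym fz)) 1≤fw Kw
    ... | refl = 1+n≢n (trans (≡-sym lw) (trans (lo-self uz) (pos-light l≤ zs)))

    -- The other two states have `s l` heavy, and two consecutive heavy vertices are excluded.
    state-light : ∀ {l} → suc l ≤ m → Heavy (suc l) → State l →
      ∃ λ z → z ≡ s l × u z ≡ z × f z ≡ 1 × (∃ λ p → p < l × 2 ≤ ℓ p × NoLightPair p l)
    state-light l< hv (spill hv′ _ _ _ _) = ⊥-elim (noHeavyPair _ l< hv′ hv)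
    state-light l< hv (heavy hv′ _ _ _ _) = ⊥-elim (noHeavyPair _ l< hv′ hv)
    state-light l< hv (light z zs uz fz p p<l 2≤ nl) = z , zs , uz , fz , p , p<l , 2≤ , nl

    extend-heavy : ∀ {p l} → Heavy (suc l) → NoLightPair p l → NoLightPair p (suc l)
    extend-heavy hv nl k p<k k<sl ¬hk ¬hsk with m≤n⇒m<n∨m≡n (≤-pred k<sl)
    ... | inj₁ k<l  = nl k p<k k<l ¬hk ¬hsk
    ... | inj₂ refl = ¬hsk hv

    extend-after-heavy : ∀ {p l} → Heavy l → NoLightPair p l → NoLightPair p (suc l)
    extend-after-heavy hv nl k p<k k<sl ¬hk ¬hsk with m≤n⇒m<n∨m≡n (≤-pred k<sl)
    ... | inj₁ k<l  = nl k p<k k<l ¬hk ¬hsk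
    ... | inj₂ refl = ¬hk hv

    -- Two leaves make the position heavy, so the state is `light` and remembers an earlier `p` with
    -- two leaves and no light pair since; this contradicts (iii).
    double-after-state : ∀ {l} → suc l ≤ m → State l → ¬ (2 ≤ ℓ (suc l))
    double-after-state l< st 2≤ with 2≤ℓ⇒heavy (≤-trans (s≤s z≤n) l<) l< 2≤
    ... | hv with state-light l< hv st
    ...   | z , zs , uz , fz , p , p<l , 2≤p , nl =
      lightPair p _ (m≤n⇒m≤1+n p<l) l< 2≤p 2≤ (extend-heavy hv nl)

    module LeafGroup {q w} (q≤m : q ≤ m) (1≤fw : 1 ≤ f w) (lw : lo w ≡ q)
      (single-w : LeafSingle w) where

      pos-w : pos w ≡ q
      pos-w = trans (≡-sym (lo-self (proj₁ single-w))) lw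

      covers-w : Covers w q
      covers-w = ≤-reflexive lw , ≤-reflexive (≡-sym (trans (hi-self (proj₁ single-w)) pos-w))

      -- By `overlapping`, any other block through `q` is again a leaf single, hence a block of
      -- length one at `q`.
      coverer : ∀ {x} → 1 ≤ f x → Covers x q → LeafSingle x × pos x ≡ q
      coverer {x} 1≤fx cx with x ≟ᶠ w
      ... | yes refl = single-w , pos-w
      ... | no ne    with overlapping q 1≤fx 1≤fw ne cx covers-w
      ...   | lx , _ = lx , ≤-antisym (subst (_≤ q) (lo-self (proj₁ lx)) (proj₁ cx))
                                      (subst (q ≤_) (hi-self (proj₁ lx)) (proj₂ cx))

      boundary : Boundary (suc q)
      boundary x 1≤fx lt = ≰⇒> λ q<hi → case coverer 1≤fx (≤-pred lt , <⇒≤ q<hi) of λ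
        { (lx , px) → <⇒≢ q<hi (≡-sym (trans (hi-self (proj₁ lx)) px)) }

      member : ∀ x → q ≤ hi x → hi x < suc q → 1 ≤ f x → LeafSingle x × pos x ≡ q
      member x q≤ lt 1≤fx = coverer 1≤fx (≤-trans (lo≤hi x) (≤-pred lt) , q≤)

      alone : ¬ (∃ λ x → 1 ≤ f x × x ≢ w × LeafSingle x × pos x ≡ q) → costTo (suc q) ≤ suc (costTo q)
      alone none = ≤-trans (partial-upper hi f (single w 1) bound)
        (≤-reflexive (trans (cong (costTo q +_) (sumF-single w 1)) (+-comm (costTo q) 1)))
        where
        bound : ∀ x → q ≤ hi x → hi x < suc q → f x ≤ single w 1 x
        bound x q≤ lt with 1 ≤? f x | x ≟ᶠ w
        ... | no ¬1≤  | _ = ≤-trans (no-f ¬1≤) z≤n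
        ... | yes _   | yes refl = ≤-reflexive (trans (leafSingle-f 1≤fw single-w) (≡-sym (single-at w 1)))
        ... | yes 1≤  | no ne = contradiction (x , 1≤ , ne , member x q≤ lt 1≤) none

      group : costTo (suc q) ≤ suc (suc (costTo q))
      group = ≤-trans (partial-upper hi f (λ x → ind (leafAt q x)) bound)
        (≤-trans (+-monoʳ-≤ (costTo q) (≤-trans (≤-reflexive (≡-sym (countF≡sumF (leafAt q))))
          (atMost2 q q≤m)))
          (≤-reflexive (+-comm (costTo q) 2)))
        where
        bound : ∀ x → q ≤ hi x → hi x < suc q → f x ≤ ind (leafAt q x)
        bound x q≤ lt with 1 ≤? f x
        ... | no ¬1≤ = ≤-trans (no-f ¬1≤) z≤n
        ... | yes 1≤ with member x q≤ lt 1≤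
        ...   | lx , px = ≤-reflexive (trans (leafSingle-f 1≤ lx) (≡-sym (cong ind (leafAt⁺ (proj₂ lx) px))))

      -- A single leaf costs 1 on one position and preserves the surplus. Its spine vertex is heavy
      -- unless the scan is over, so the previous state was `light`, and the alternation continues
      -- in `heavy` with the same `p`.
      alone-inv : costTo (suc q) ≤ suc (costTo q) → Inv q → Inv (suc q)
      alone-inv le (low c≤) = low (≤-trans le (s≤s c≤))
      alone-inv le (high {l} c≤ st) = high (≤-trans le (s≤s c≤)) λ q< →
        let hv = heavy-inner (s≤s z≤n) q< (proj₂ single-w) pos-w in
        case state-light q≤m hv (st q≤m) of λ
          { (z , zs , uz , fz , p , p<l , 2≤ , nl) →
            heavy hv p (m≤n⇒m≤1+n (<⇒≤ p<l)) 2≤ (extend-heavy hv nl) }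

      -- A pair creates a surplus and starts a new alternation with `p = q`; with a surplus already
      -- present it is impossible.
      group-inv : 2 ≤ ℓ q → costTo (suc q) ≤ suc (suc (costTo q)) → Inv q → Inv (suc q)
      group-inv 2≤ le (low c≤) = high (≤-trans le (s≤s (s≤s c≤))) λ q< →
        heavy (2≤ℓ⇒heavy (≤-trans (s≤s z≤n) q<) q≤m 2≤) q ≤-refl 2≤
          (λ k q<k k<q _ _ → <-asym q<k k<q)
      group-inv 2≤ le (high c≤ st) = contradiction 2≤ (double-after-state q≤m (st q≤m))

      next : Inv q → Next q
      next inv with any? (λ x → (1 ≤? f x) ×-dec (¬? (x ≟ᶠ w) ×-dec (leafSingle? x ×-dec (pos x ≟ q))))
      ... | no none = suc q , ≤-refl , s≤s q≤m , boundary , alone-inv (alone none) inv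
      ... | yes (x , _ , ne , lx , px) = suc q , ≤-refl , s≤s q≤m , boundary
        , group-inv (2≤ℓ (proj₂ lx) (proj₂ single-w) px pos-w ne) group inv

    module Path {q w} (q≤m : q ≤ m) (1≤fw : 1 ≤ f w) (lw : lo w ≡ q)
      (¬single-w : ¬ LeafSingle w) where

      q≤hi : q ≤ hi w
      q≤hi = subst (_≤ hi w) lw (lo≤hi w)

      disjoint : ∀ {x} j → 1 ≤ f x → x ≢ w → q ≤ j → j ≤ hi w → ¬ Covers x j
      disjoint j 1≤fx ne q≤j j≤ cx = ¬single-w
        (proj₂ (overlapping j 1≤fx 1≤fw ne cx (≤-trans (≤-reflexive lw) q≤j , j≤)))

      boundary : Boundary (suc (hi w))
      boundary x 1≤fx lt with x ≟ᶠ w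
      ... | yes refl = ≤-refl
      ... | no ne    = ≰⇒> λ hi< → disjoint (hi w) 1≤fx ne q≤hi ≤-refl (≤-pred lt , <⇒≤ hi<)

      bound : costTo (suc (hi w)) ≤ costTo q + f w
      bound = ≤-trans (partial-upper hi f (single w (f w)) pointwise)
        (≤-reflexive (cong (costTo q +_) (sumF-single w (f w))))
        where
        pointwise : ∀ x → q ≤ hi x → hi x < suc (hi w) → f x ≤ single w (f w) x
        pointwise x q≤ lt with x ≟ᶠ w | 1 ≤? f x
        ... | yes refl | _       = ≤-reflexive (≡-sym (single-at w (f w)))
        ... | no _     | no ¬1≤  = ≤-trans (no-f ¬1≤) z≤n
        ... | no ne    | yes 1≤  = contradiction (lo≤hi x , ≤-refl) (disjoint (hi x) 1≤ ne q≤ (≤-pred lt))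

      next : Inv (suc (hi w)) → Next q
      next inv = suc (hi w) , s≤s q≤hi , s≤s (hi≤m w) , boundary , inv

      module SpineSingle (uw : u w ≡ w) (fw : f w ≡ 1) (nl : NonLeaf w) where

        pos-w : pos w ≡ q
        pos-w = trans (≡-sym (lo-self uw)) lw

        w≡s : w ≡ s q
        w≡s = trans (≡-sym (s-pos w nl)) (cong s pos-w)

        hi≡q : hi w ≡ q
        hi≡q = trans (hi-self uw) pos-w

        bound′ : costTo (suc q) ≤ suc (costTo q)
        bound′ = subst₂ (λ a b → costTo (suc a) ≤ b) hi≡q
          (trans (cong (costTo q +_) fw) (+-comm (costTo q) 1)) bound

        inv′ : Inv q → Inv (suc q)
        inv′ (low c≤) = low (≤-trans bound′ (s≤s c≤))
        inv′ (high {l} c≤ st) = high (≤-trans bound′ (s≤s c≤)) λ q< → after (st q≤m)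
          where
          -- The vertex is its own private vertex, so it must not hear anything from the left. Only
          -- the state `heavy` permits this.
          after : State l → State (suc l)
          after (spill _ z 1≤fz hz Kz) = contradiction (trans uw w≡s)
            (spill-blocks q≤m (z , 1≤fz , hz , Kz) 1≤fw lw)
          after (heavy hv p p≤l 2≤ nlp) = light w w≡s uw fw p (s≤s p≤l) 2≤ (extend-after-heavy hv nlp)
          after (light z zs uz fz _ _ _ _) = contradiction (trans uw w≡s)
            (spill-blocks q≤m (light-spills (<⇒≤ q≤m) zs uz fz) 1≤fw lw)

        done : Inv q → Next q
        done inv = next (subst (λ c → Inv (suc c)) (≡-sym hi≡q) (inv′ inv))

      -- `t` counts the spine steps of the block, and `ends` tells whether `w` or its private vertex
      -- is at the left end.
      module Proper (t : ℕ) (hi≡ : hi w ≡ q + t) (w≢u : w ≢ u w)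
        (fw : f w ≡ t + (h w + h (u w)))
        (ends : (pos w ≡ q × pos (u w) ≡ q + t) ⊎ (pos w ≡ q + t × pos (u w) ≡ q)) where

        bound′ : costTo (suc (q + t)) ≤ costTo q + (t + (h w + h (u w)))
        bound′ = subst₂ (λ a b → costTo (suc a) ≤ costTo q + b) hi≡ fw bound

        q+t≤m : q + t ≤ m
        q+t≤m = subst (_≤ m) hi≡ (hi≤m w)

        K-forward : pos w ≡ q → K w (suc (q + t)) ≡ suc t + h w
        K-forward e = cong (_+ h w) (trans (cong₂ ∣_-_∣ e (≡-sym (+-suc q t))) (∣m-m+n∣≡n q (suc t)))

        K-far-end : pos w ≡ q + t → K w (suc (q + t)) ≡ 1 + h w
        K-far-end e = cong (_+ h w) (trans (cong (∣_- suc (q + t) ∣) e) (∣n-1+n∣≡1 (q + t)))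

        -- `b` is the surplus before the block and `k` its number of leaf ends. The block has
        -- `t + 1` positions and costs `t + k`, so the surplus changes by `k - 1`.
        cost-bound : ∀ {b k} → costTo q ≤ b + q → h w + h (u w) ≡ k → costTo (suc (q + t)) ≤ (b + k) + (q + t)
        cost-bound {b} {k} c≤ hk = ≤-trans bound′ (≤-trans (+-monoˡ-≤ _ c≤) (≤-reflexive
          (trans (cong (λ z → (b + q) + (t + z)) hk)
            (trans (cong (b + q +_) (+-comm t k)) (+-interchange b q k t)))))

        pos-w≤ : pos w ≤ q + t
        pos-w≤ = subst (pos w ≤_) hi≡ (m≤m⊔n (pos w) (pos (u w)))

        pos-u≤ : pos (u w) ≤ q + t
        pos-u≤ = subst (pos (u w) ≤_) hi≡ (m≤n⊔m (pos w) (pos (u w)))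

        ≤pos-w : q ≤ pos w
        ≤pos-w = subst (_≤ pos w) lw (m⊓n≤m (pos w) (pos (u w)))

        ≤pos-u : q ≤ pos (u w)
        ≤pos-u = subst (_≤ pos (u w)) lw (m⊓n≤n (pos w) (pos (u w)))

        K≤f : ∀ {a b k} j → K w j ≡ a + h w → h w ≡ b → h w + h (u w) ≡ k → a + b ≤ t + k → K w j ≤ f w
        K≤f {a} j Kw hw hk le = subst₂ _≤_ (≡-sym (trans Kw (cong (a +_) hw)))
          (≡-sym (trans fw (cong (t +_) hk))) le

        spill-here : Heavy (q + t) → K w (suc (q + t)) ≤ f w → State (q + t)
        spill-here hv = spill hv w 1≤fw (≤-reflexive hi≡)

        module BothLeaves (lfw : Leaf w) (lfu : Leaf (u w)) where

          h≡2 : h w + h (u w) ≡ 2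
          h≡2 = cong₂ _+_ (leaf⇒h≡1 lfw) (leaf⇒h≡1 lfu)

          leaf-at-end : ∃ λ x → Leaf x × pos x ≡ q + t
          leaf-at-end = [ (λ e → u w , lfu , proj₂ e) , (λ e → w , lfw , proj₁ e) ]′ ends

          leaf-at-start : ∃ λ x → Leaf x × pos x ≡ q
          leaf-at-start = [ (λ e → w , lfw , proj₁ e) , (λ e → u w , lfu , proj₂ e) ]′ ends

          heavy-end : suc (q + t) ≤ m → Heavy (q + t)
          heavy-end c< with 1 ≤? q + t
          ... | yes 1≤c = heavy-inner 1≤c c< (proj₁ (proj₂ leaf-at-end)) (proj₂ (proj₂ leaf-at-end))
          ... | no ¬1≤c = heavy-double (≤-trans (s≤s z≤n) c<) q+t≤m lfw lfu (at-end ≤pos-w pos-w≤)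
              (at-end ≤pos-u pos-u≤) w≢u
            where
            at-end : ∀ {a} → q ≤ a → a ≤ q + t → a ≡ q + t
            at-end _ le = ≤-antisym le (≤-trans (≤-pred (≰⇒> ¬1≤c)) z≤n)

          heavy-start : 1 ≤ q → Heavy q
          heavy-start 1≤q with m≤n⇒m<n∨m≡n q≤m
          ... | inj₁ q<m = heavy-inner 1≤q q<m (proj₁ (proj₂ leaf-at-start)) (proj₂ (proj₂ leaf-at-start))
          ... | inj₂ q≡m = heavy-double (≤-trans 1≤q q≤m) q≤m lfw lfu
            (≤-antisym (subst (pos w ≤_) (≡-sym q≡m) (pos≤m w)) ≤pos-w)
            (≤-antisym (subst (pos (u w) ≤_) (≡-sym q≡m) (pos≤m (u w))) ≤pos-u) w≢u

          reaches-beyond : K w (suc (q + t)) ≤ f w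
          reaches-beyond =
            [ (λ e → K≤f _ (K-forward (proj₁ e)) (leaf⇒h≡1 lfw) h≡2 (≤-reflexive (≡-sym (+-suc t 1))))
            , (λ e → K≤f _ (K-far-end (proj₁ e)) (leaf⇒h≡1 lfw) h≡2 (m≤n+m 2 t)) ]′ ends

          -- Strength `t + 2` reaches one spine vertex beyond either end of the block. To the right
          -- this gives `spill`; to the left it contradicts a surplus, because the heavy start
          -- leaves only the state `light`, whose `s l` would be hit.
          inv′ : Inv q → Inv (suc (q + t))
          inv′ (low c≤) = high (cost-bound {0} c≤ h≡2) λ c< → spill-here (heavy-end c<) reaches-beyond
          inv′ (high {l} c≤ st) = ⊥-elim (case state-light q≤m (heavy-start (s≤s z≤n)) (st q≤m) of λ
            { (z , zs , uz , fz , _) → light-blocks (<⇒≤ q≤m) zs uz fz 1≤fw lw (reaches-back ends) })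
            where
            reaches-back : (pos w ≡ suc l × pos (u w) ≡ suc l + t) ⊎ (pos w ≡ suc l + t × pos (u w) ≡ suc l) →
              K w l ≤ f w
            reaches-back (inj₁ (pw , _)) = K≤f l (K-back {w} 0 (trans pw (≡-sym (+-identityʳ _))))
              (leaf⇒h≡1 lfw) h≡2 (m≤n+m 2 t)
            reaches-back (inj₂ (pw , _)) = K≤f l (K-back {w} t pw) (leaf⇒h≡1 lfw) h≡2
              (≤-reflexive (≡-sym (+-suc t 1)))

        -- If the leaf `w` is on the left, the state is `light`: for `t ≥ 1` the block reaches back
        -- to `s l`, and for `t = 0` its private `s q` is already heard. If `w` is on the right,
        -- `s q` is private, which leaves `heavy`; then `t ≥ 1` because no two heavy vertices are
        -- consecutive, and the block spills.
        leaf-spine : Leaf w → NonLeaf (u w) → suc (q + t) ≤ m → (∃ λ l → q ≡ suc l × State l) → State (q + t)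
        leaf-spine lfw nlu c< (l , refl , st) = by-ends ends
          where
          h≡1 : h w + h (u w) ≡ 1
          h≡1 = cong₂ _+_ (leaf⇒h≡1 lfw) (nonleaf⇒h≡0 nlu)
          u≡s : pos (u w) ≡ suc l → u w ≡ s (suc l)
          u≡s pu = trans (≡-sym (s-pos (u w) nlu)) (cong s pu)
          reach-2 : 1 ≤ t → 1 + 1 ≤ t + 1
          reach-2 1≤t = +-monoˡ-≤ 1 1≤t
          by-ends : (pos w ≡ suc l × pos (u w) ≡ suc l + t) ⊎ (pos w ≡ suc l + t × pos (u w) ≡ suc l) →
            State (suc l + t)
          by-ends (inj₁ (pw , pu)) = ⊥-elim (case state-light q≤m
            (heavy-inner (s≤s z≤n) (≤-trans (s≤s (m≤m+n (suc l) t)) c<) lfw pw) st of λ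
            { (z , zs , uz , fz , _) → case 1 ≤? t of λ
              { (yes 1≤t) → light-blocks (<⇒≤ q≤m) zs uz fz 1≤fw lw
                  (K≤f l (K-back {w} 0 (trans pw (≡-sym (+-identityʳ _)))) (leaf⇒h≡1 lfw) h≡1 (reach-2 1≤t))
              ; (no ¬1≤t) → spill-blocks q≤m (light-spills (<⇒≤ q≤m) zs uz fz) 1≤fw lw
                  (u≡s (trans pu (trans (cong (suc l +_) (n≤0⇒n≡0 (≤-pred (≰⇒> ¬1≤t))))
                    (+-identityʳ _)))) } })
          by-ends (inj₂ (pw , pu)) = by-state st
            where
            hv : Heavy (suc l + t)
            hv = heavy-inner (s≤s z≤n) c< lfw pw
            by-state : State l → State (suc l + t)
            by-state (spill _ z 1≤fz hz Kz) = ⊥-elim (spill-blocks q≤m (z , 1≤fz , hz , Kz) 1≤fw lw (u≡s pu))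
            by-state (light z zs uz fz _ _ _ _) =
              ⊥-elim (spill-blocks q≤m (light-spills (<⇒≤ q≤m) zs uz fz) 1≤fw lw (u≡s pu))
            by-state (heavy hv′ _ _ _ _) with 1 ≤? t
            ... | yes 1≤t = spill-here hv (K≤f _ (K-far-end pw) (leaf⇒h≡1 lfw) h≡1 (reach-2 1≤t))
            ... | no ¬1≤t = ⊥-elim (noHeavyPair l q≤m hv′
              (subst Heavy (trans (cong (suc l +_) (n≤0⇒n≡0 (≤-pred (≰⇒> ¬1≤t)))) (+-identityʳ _)) hv))

        -- From the spine, strength `t + 1` covers `t + 1` spine steps. So `w` on the left spills
        -- beyond the block, and `w` on the right would reach back to the private `s l` of the state
        -- `light`.
        spine-leaf : NonLeaf w → Leaf (u w) → suc (q + t) ≤ m → (∃ λ l → q ≡ suc l × State l) → State (q + t)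
        spine-leaf nlw lfu c< (l , refl , st) = by-ends ends
          where
          h≡1 : h w + h (u w) ≡ 1
          h≡1 = cong₂ _+_ (nonleaf⇒h≡0 nlw) (leaf⇒h≡1 lfu)
          t+1 : suc t + 0 ≤ t + 1
          t+1 = ≤-reflexive (trans (+-identityʳ (suc t)) (+-comm 1 t))
          by-ends : (pos w ≡ suc l × pos (u w) ≡ suc l + t) ⊎ (pos w ≡ suc l + t × pos (u w) ≡ suc l) →
            State (suc l + t)
          by-ends (inj₁ (pw , pu)) = spill-here (heavy-inner (s≤s z≤n) c< lfu pu)
            (K≤f _ (K-forward pw) (nonleaf⇒h≡0 nlw) h≡1 t+1)
          by-ends (inj₂ (pw , pu)) = ⊥-elim (case state-light q≤m
            (heavy-inner (s≤s z≤n) (≤-trans (s≤s (m≤m+n (suc l) t)) c<) lfu pu) st of λ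
            { (z , zs , uz , fz , _) → light-blocks (<⇒≤ q≤m) zs uz fz 1≤fw lw
                (K≤f l (K-back {w} t pw) (nonleaf⇒h≡0 nlw) h≡1 t+1) })

        one-leaf-inv : h w + h (u w) ≡ 1 → (suc (q + t) ≤ m → (∃ λ l → q ≡ suc l × State l) → State (q + t)) →
          Inv q → Inv (suc (q + t))
        one-leaf-inv h≡1 state (low c≤)         = low (cost-bound {0} c≤ h≡1)
        one-leaf-inv h≡1 state (high {l} c≤ st) = high (cost-bound {1} c≤ h≡1) λ c< →
          state c< (l , refl , st q≤m)

        inv : Inv q → Inv (suc (q + t))
        inv i with kind w | kind (u w)
        ... | inj₁ (lfw , _) | inj₁ (lfu , _) = BothLeaves.inv′ lfw lfu i
        ... | inj₁ (lfw , hw) | inj₂ (nlu , hu) = one-leaf-inv (cong₂ _+_ hw hu) (leaf-spine lfw nlu) i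
        ... | inj₂ (nlw , hw) | inj₁ (lfu , hu) = one-leaf-inv (cong₂ _+_ hw hu) (spine-leaf nlw lfu) i
        -- With both ends on the spine the block costs `t` on `t + 1` positions and removes any
        -- surplus.
        ... | inj₂ (nlw , hw) | inj₂ (nlu , hu) = low (cost-bound {1} {0} (Inv⇒≤ i) (cong₂ _+_ hw hu))

        done : Inv q → Next q
        done i = next (subst (λ c → Inv (suc c)) (≡-sym hi≡) (inv i))

      advance : Inv q → Next q
      advance i with tight w 1≤fw
      ... | inj₂ (uw , fw) = SpineSingle.done uw fw (¬true⇒false λ lfw → ¬single-w (uw , lfw)) i
      ... | inj₁ (ne , e) with ≤-total (pos w) (pos (u w))
      ...   | inj₁ le with m≤n⇒∃[o]m+o≡n le
      ...     | t , e′ = Proper.done t hi≡ ne fw (inj₁ (pw , pu)) i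
        where
        pw : pos w ≡ q
        pw = trans (≡-sym (m≤n⇒m⊓n≡m le)) lw
        pu : pos (u w) ≡ q + t
        pu = trans (≡-sym e′) (cong (_+ t) pw)
        hi≡ : hi w ≡ q + t
        hi≡ = trans (m≤n⇒m⊔n≡n le) pu
        fw : f w ≡ t + (h w + h (u w))
        fw = trans (≡-sym e) (trans (dist-diff ne) (cong (_+ (h w + h (u w)))
          (trans (cong₂ ∣_-_∣ pw pu) (∣m-m+n∣≡n q t))))
      advance i | inj₁ (ne , e) | inj₂ ge with m≤n⇒∃[o]m+o≡n ge
      ...     | t , e′ = Proper.done t hi≡ ne fw (inj₂ (pw , pu)) i
        where
        pu : pos (u w) ≡ q
        pu = trans (≡-sym (m≥n⇒m⊓n≡n ge)) lw
        pw : pos w ≡ q + t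
        pw = trans (≡-sym e′) (cong (_+ t) pu)
        hi≡ : hi w ≡ q + t
        hi≡ = trans (m≥n⇒m⊔n≡m ge) pw
        fw : f w ≡ t + (h w + h (u w))
        fw = trans (≡-sym e) (trans (dist-diff ne) (cong (_+ (h w + h (u w)))
          (trans (cong₂ ∣_-_∣ pw pu) (∣m+n-m∣≡n q t))))

    step : ∀ {q} → q ≤ m → Boundary q → Inv q → Next q
    step {q} q≤m bd i with any? (λ w → (1 ≤? f w) ×-dec (lo w ≟ q))
    ... | no none = uncovered q≤m bd i none
    ... | yes (w , 1≤fw , lw) with leafSingle? w
    ...   | yes sw = LeafGroup.next q≤m 1≤fw lw sw i
    ...   | no ¬sw = Path.advance q≤m 1≤fw lw ¬sw i

    -- The cut moves strictly to the right in each step, so `q + fuel` never falls below `suc m` and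
    -- the fuel cannot run out early.
    run : ∀ fuel q → suc m ≤ q + fuel → q ≤ suc m → Boundary q → Inv q → costTo (suc m) ≤ suc (suc m)
    run fuel q enough q≤ bd i with q ≤? m
    ... | no q≰m = subst (λ k → costTo k ≤ suc k) (≤-antisym q≤ (≰⇒> q≰m)) (Inv⇒≤ i)
    run zero q enough q≤ bd i | yes q≤m =
      contradiction (≤-trans enough (≤-trans (≤-reflexive (+-identityʳ q)) q≤m)) 1+n≰n
    run (suc fuel) q enough q≤ bd i | yes q≤m with step q≤m bd i
    ... | r , q<r , r≤ , bd′ , i′ = run fuel r
      (≤-trans enough (≤-trans (≤-reflexive (+-suc q fuel)) (+-monoˡ-≤ fuel q<r))) r≤ bd′ i′

    cost≤m+2 : cost G f ≤ m + 2
    cost≤m+2 = ≤-trans (sumF≤partial hi f (λ w → s≤s (hi≤m w))) (≤-trans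
      (run (suc m) 0 ≤-refl z≤n (λ _ _ ()) (low (≤-reflexive (partial-0 hi f))))
      (≤-reflexive (+-comm 2 m)))

-- Constructions of minimal dominating broadcasts.

module Constructions (G : Graph) (S : Spine G) where
  open SpineDegrees G S

  dist-e₁ : ∀ {x} → x ≢ e₁ → dist G e₁ x ≡ (m ∸ pos x) + (1 + h x)
  dist-e₁ {x} ne = trans (dist-diff (ne ∘ ≡-sym)) (cong₂ _+_
    (trans (cong (∣_- pos x ∣) pos-e₁) (m≤n⇒∣n-m∣≡n∸m (pos≤m x))) (cong (_+ h x) (leaf⇒h≡1 leaf-e₁)))

  dist-e₀≤ : ∀ x → dist G e₀ x ≤ pos x + (1 + h x)
  dist-e₀≤ x with x ≟ᶠ e₀
  ... | yes refl = subst (_≤ pos x + (1 + h x)) (≡-sym (dist-same x)) z≤n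
  ... | no ne    = ≤-reflexive (dist-e₀ ne)

  dist-e₁≤ : ∀ x → dist G e₁ x ≤ (m ∸ pos x) + (1 + h x)
  dist-e₁≤ x with x ≟ᶠ e₁
  ... | yes refl = subst (_≤ (m ∸ pos x) + (1 + h x)) (≡-sym (dist-same x)) z≤n
  ... | no ne    = ≤-reflexive (dist-e₁ ne)

  dist≤ecc : ∀ w x → dist G w x ≤ ecc G w
  dist≤ecc w x = ≤maxF (dist G w) x

  1≤ecc : ∀ w → 1 ≤ ecc G w
  1≤ecc w with w ≟ᶠ e₀
  ... | yes refl = ≤-trans (n≢0⇒n>0 (e₀≢e₁ ∘ dist≡0)) (dist≤ecc w e₁)
  ... | no ne    = ≤-trans (n≢0⇒n>0 (ne ∘ dist≡0)) (dist≤ecc w e₀)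

  -- Only `e₀` broadcasts, with strength equal to the diameter, and `e₁` is its private vertex.
  diametrical-broadcast : ∃ λ f → MinimalDominating G f × cost G f ≡ m + 2
  diametrical-broadcast = f , private⇒minimal G f broadcast dominating priv , sumF-single e₀ (m + 2)
    where
    f : Vertex G → ℕ
    f = single e₀ (m + 2)
    source : ∀ w → 1 ≤ f w → w ≡ e₀
    source w 1≤ with w ≟ᶠ e₀
    ... | yes e = e
    ... | no ne = contradiction (subst (1 ≤_) (single-off e₀ w (m + 2) ne) 1≤) λ ()
    broadcast : IsBroadcast G f
    broadcast = single-≤ e₀ (m + 2) (ecc G) (subst (_≤ ecc G e₀) dist-e₀-e₁ (dist≤ecc e₀ e₁))
    dominating : Dominating G f
    dominating x = e₀
      , subst (1 ≤_) (≡-sym (single-at e₀ (m + 2))) (≤-trans (s≤s z≤n) (m≤n+m 2 m))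
      , subst (dist G e₀ x ≤_) (≡-sym (single-at e₀ (m + 2))) (dist≤m+2 e₀ x)
    priv : ∀ w → 1 ≤ f w → ∃ λ u → OnlyDominator G f w u × (f w ≤ dist G w u ⊎ f w ≤ 1)
    priv w 1≤ with source w 1≤
    ... | refl = e₁ , (λ x 1≤fx _ → source x 1≤fx)
      , inj₁ (≤-reflexive (trans (single-at e₀ (m + 2)) (≡-sym dist-e₀-e₁)))

  module HeavyPair {p : ℕ} (p< : suc p ≤ m) (heavy-p : Heavy p) (heavy-p′ : Heavy (suc p)) where

    1≤m : 1 ≤ m
    1≤m = ≤-trans (s≤s z≤n) p<

    -- The strengths are just enough for `e₀` to reach the leaves at `p` and for `e₁` to reach those
    -- at `suc p`. Since both positions are heavy, each has a leaf besides `e₀` and `e₁`, and the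
    -- opposite end misses it by 1.
    f : Vertex G → ℕ
    f x = single e₀ (p + 2) x + single e₁ ((m ∸ suc p) + 2) x

    f-e₀ : f e₀ ≡ p + 2
    f-e₀ = trans (cong₂ _+_ (single-at e₀ (p + 2)) (single-off e₁ e₀ _ e₀≢e₁)) (+-identityʳ (p + 2))

    f-e₁ : f e₁ ≡ (m ∸ suc p) + 2
    f-e₁ = cong₂ _+_ (single-off e₀ e₁ (p + 2) (e₀≢e₁ ∘ ≡-sym)) (single-at e₁ _)

    source : ∀ w → 1 ≤ f w → w ≡ e₀ ⊎ w ≡ e₁
    source w 1≤ with w ≟ᶠ e₀ | w ≟ᶠ e₁
    ... | yes e | _     = inj₁ e
    ... | no _  | yes e = inj₂ e
    ... | no ne | no ne′ = contradiction
      (subst (1 ≤_) (cong₂ _+_ (single-off e₀ w _ ne) (single-off e₁ w _ ne′)) 1≤) λ ()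

    cost≡ : cost G f ≡ suc (m + 2)
    cost≡ = trans (sumF-+ (single e₀ (p + 2)) (single e₁ ((m ∸ suc p) + 2)))
      (trans (cong₂ _+_ (sumF-single e₀ (p + 2)) (sumF-single e₁ _))
        (trans (cong (_+ ((m ∸ suc p) + 2)) (+-suc p 1))
          (trans (cong (_+ ((m ∸ suc p) + 2)) (cong suc (+-comm p 1)))
          (cong suc (trans (≡-sym (+-assoc (suc p) (m ∸ suc p) 2)) (cong (_+ 2) (m+[n∸m]≡n p<)))))))

    dist-e₀-leaf : ∀ {x j} → Leaf x → pos x ≡ j → x ≢ e₀ → dist G e₀ x ≡ j + 2
    dist-e₀-leaf lx px ne = trans (dist-e₀ ne) (cong₂ (λ a b → a + (1 + b)) px (leaf⇒h≡1 lx))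

    dist-e₁-leaf : ∀ {x j} → Leaf x → pos x ≡ j → x ≢ e₁ → dist G e₁ x ≡ (m ∸ j) + 2
    dist-e₁-leaf lx px ne = trans (dist-e₁ ne) (cong₂ (λ a b → (m ∸ a) + (1 + b)) px (leaf⇒h≡1 lx))

    dominating : Dominating G f
    dominating x with pos x ≤? p
    ... | yes le = e₀ , subst (1 ≤_) (≡-sym f-e₀) (≤-trans (s≤s z≤n) (m≤n+m 2 p))
      , subst (dist G e₀ x ≤_) (≡-sym f-e₀) (≤-trans (dist-e₀≤ x) (+-mono-≤ le (s≤s (h≤1 x))))
    ... | no ¬le = e₁ , subst (1 ≤_) (≡-sym f-e₁) (≤-trans (s≤s z≤n) (m≤n+m 2 (m ∸ suc p)))
      , subst (dist G e₁ x ≤_) (≡-sym f-e₁)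
          (≤-trans (dist-e₁≤ x) (+-mono-≤ (∸-monoʳ-≤ m (≰⇒> ¬le)) (s≤s (h≤1 x))))

    x-leaf = heavy⇒leaf 1≤m (<⇒≤ p<) heavy-p
    y-leaf = heavy⇒leaf 1≤m p< heavy-p′

    x y : Vertex G
    x = proj₁ x-leaf
    y = proj₁ y-leaf

    e₀-x : dist G e₀ x ≡ p + 2
    e₀-x with x-leaf
    ... | _ , lx , px , ne , _ = dist-e₀-leaf lx px ne

    e₁-x : dist G e₁ x ≡ (m ∸ p) + 2
    e₁-x with x-leaf
    ... | _ , lx , px , _ , ne = dist-e₁-leaf lx px ne

    e₀-y : dist G e₀ y ≡ suc p + 2
    e₀-y with y-leaf
    ... | _ , ly , py , ne , _ = dist-e₀-leaf ly py ne

    e₁-y : dist G e₁ y ≡ (m ∸ suc p) + 2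
    e₁-y with y-leaf
    ... | _ , ly , py , _ , ne = dist-e₁-leaf ly py ne

    priv : ∀ w → 1 ≤ f w → ∃ λ u → OnlyDominator G f w u × (f w ≤ dist G w u ⊎ f w ≤ 1)
    priv w 1≤ with source w 1≤
    ... | inj₁ refl = x , only , inj₁ (≤-reflexive (trans f-e₀ (≡-sym e₀-x)))
      where
      only : OnlyDominator G f e₀ x
      only z 1≤fz d≤ with source z 1≤fz
      ... | inj₁ e    = e
      ... | inj₂ refl = contradiction (+-cancelʳ-≤ 2 _ _ (subst₂ _≤_ e₁-x f-e₁ d≤))
        (<⇒≱ (≤-reflexive (≡-sym (m∸n≡1+[m∸1+n] p<))))
    ... | inj₂ refl = y , only , inj₁ (≤-reflexive (trans f-e₁ (≡-sym e₁-y)))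
      where
      only : OnlyDominator G f e₁ y
      only z 1≤fz d≤ with source z 1≤fz
      ... | inj₂ e    = e
      ... | inj₁ refl = contradiction (+-cancelʳ-≤ 2 _ _ (subst₂ _≤_ e₀-y f-e₀ d≤)) 1+n≰n

    broadcast : IsBroadcast G f
    broadcast w with 1 ≤? f w
    ... | no ¬1≤ = ≤-trans (≤-pred (≰⇒> ¬1≤)) z≤n
    ... | yes 1≤ with source w 1≤
    ...   | inj₁ refl = ≤-trans (≤-reflexive (trans f-e₀ (≡-sym e₀-x))) (dist≤ecc e₀ x)
    ...   | inj₂ refl = ≤-trans (≤-reflexive (trans f-e₁ (≡-sym e₁-y))) (dist≤ecc e₁ y)

    minimal : MinimalDominating G f
    minimal = private⇒minimal G f broadcast dominating priv

  module LeafSegment {i j : ℕ} (i≤j : i ≤ j) (j≤m : j ≤ m) (2≤ℓi : 2 ≤ ℓ i) (2≤ℓj : 2 ≤ ℓ j)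
    (noHeavyPair : ∀ k → suc k ≤ m → Heavy k → Heavy (suc k) → ⊥)
    (noLightPair : ∀ k → i < k → k < j → ¬ Heavy k → ¬ Heavy (suc k) → ⊥) where

    inner : Bool → ℕ → ℕ
    inner true  _       = 1
    inner false zero    = 1
    inner false (suc _) = 0

    -- Left of the segment only `e₀` broadcasts, right of it only `e₁`. For `i = 0` or `j = m` that
    -- side is empty and the end leaf counts as an inner leaf of strength 1.
    choose : ∀ x → Dec (pos x < i) → Dec (j < pos x) → ℕ
    choose x (yes _) _       = single e₀ i x
    choose x (no _)  (yes _) = single e₁ (m ∸ j) x
    choose x (no _)  (no _)  = inner (isLeaf G x) (ℓ (pos x))

    f : Vertex G → ℕ
    f x = choose x (pos x <? i) (j <? pos x)

    f-left : ∀ {x} → pos x < i → f x ≡ single e₀ i x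
    f-left {x} lt with pos x <? i
    ... | yes _ = refl
    ... | no ¬p = contradiction lt ¬p

    f-right : ∀ {x} → j < pos x → f x ≡ single e₁ (m ∸ j) x
    f-right {x} lt with pos x <? i | j <? pos x
    ... | yes lt′ | _     = contradiction (<-trans (≤-trans lt′ i≤j) lt) 1+n≰n
    ... | no _    | yes _ = refl
    ... | no _    | no ¬p = contradiction lt ¬p

    f-inner : ∀ {x} → i ≤ pos x → pos x ≤ j → f x ≡ inner (isLeaf G x) (ℓ (pos x))
    f-inner {x} i≤ ≤j with pos x <? i | j <? pos x
    ... | yes lt | _      = contradiction i≤ (<⇒≱ lt)
    ... | no _   | yes lt = contradiction ≤j (<⇒≱ lt)
    ... | no _   | no _   = refl

    f-leaf : ∀ {x} → Leaf x → i ≤ pos x → pos x ≤ j → f x ≡ 1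
    f-leaf {x} lx i≤ ≤j = trans (f-inner i≤ ≤j) (cong (λ b → inner b (ℓ (pos x))) lx)

    f-spine : ∀ {x} → NonLeaf x → i ≤ pos x → pos x ≤ j → ℓ (pos x) ≡ 0 → f x ≡ 1
    f-spine nx i≤ ≤j e = trans (f-inner i≤ ≤j) (cong₂ inner nx e)

    f-e₀ : 1 ≤ i → f e₀ ≡ i
    f-e₀ 1≤i = trans (f-left (subst (_< i) (≡-sym pos-e₀) 1≤i)) (single-at e₀ i)

    f-e₁ : suc j ≤ m → f e₁ ≡ m ∸ j
    f-e₁ j<m = trans (f-right (subst (j <_) (≡-sym pos-e₁) j<m)) (single-at e₁ (m ∸ j))

    data Source (w : Vertex G) : Set where
      left  : w ≡ e₀ → 1 ≤ i → f w ≡ i → Source w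
      right : w ≡ e₁ → suc j ≤ m → f w ≡ m ∸ j → Source w
      leaf  : Leaf w → i ≤ pos w → pos w ≤ j → f w ≡ 1 → Source w
      spine : NonLeaf w → i ≤ pos w → pos w ≤ j → ℓ (pos w) ≡ 0 → f w ≡ 1 → Source w

    source : ∀ w → 1 ≤ f w → Source w
    source w 1≤ = by-region (pos w <? i) (j <? pos w)
      where
      at-left : pos w < i → Dec (w ≡ e₀) → Source w
      at-left lt (yes refl) = left refl (≤-trans (s≤s z≤n) lt) (trans (f-left lt) (single-at e₀ i))
      at-left lt (no ne)    = contradiction (subst (1 ≤_) (trans (f-left lt) (single-off e₀ w i ne)) 1≤) λ ()
      at-right : j < pos w → Dec (w ≡ e₁) → Source w
      at-right lt (yes refl) = right refl (≤-trans lt (pos≤m w)) (trans (f-right lt) (single-at e₁ (m ∸ j)))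
      at-right lt (no ne)    = contradiction (subst (1 ≤_)
        (trans (f-right lt) (single-off e₁ w (m ∸ j) ne)) 1≤) λ ()
      by-ℓ : i ≤ pos w → pos w ≤ j → NonLeaf w → ∀ k → ℓ (pos w) ≡ k → Source w
      by-ℓ i≤ ≤j nw zero    e = spine nw i≤ ≤j e (f-spine nw i≤ ≤j e)
      by-ℓ i≤ ≤j nw (suc k) e = contradiction (subst (1 ≤_) (trans (f-inner i≤ ≤j) (cong₂ inner nw e)) 1≤)
        λ ()
      by-region : Dec (pos w < i) → Dec (j < pos w) → Source w
      by-region (yes lt) _        = at-left lt (w ≟ᶠ e₀)
      by-region (no _)   (yes lt) = at-right lt (w ≟ᶠ e₁)
      by-region (no i≤)  (no ≤j)  with kind w
      ... | inj₁ (lw , _) = leaf lw (≮⇒≥ i≤) (≮⇒≥ ≤j) (f-leaf lw (≮⇒≥ i≤) (≮⇒≥ ≤j))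
      ... | inj₂ (nw , _) = by-ℓ (≮⇒≥ i≤) (≮⇒≥ ≤j) nw (ℓ (pos w)) refl

    -- One step goes from `e₀` to `s 0`, so strength `i` ends at `s (i - 1)` and stays outside the
    -- segment.
    reach-left : 1 ≤ i → ∀ {x} → dist G e₀ x ≤ i → pos x < i
    reach-left 1≤i {x} d≤ with x ≟ᶠ e₀
    ... | yes refl = subst (_< i) (≡-sym pos-e₀) 1≤i
    ... | no ne    = m+n≤o⇒m≤o (suc (pos x))
      (subst (_≤ i) (trans (dist-e₀ ne) (+-suc (pos x) (h x))) d≤)

    reach-right : suc j ≤ m → ∀ {x} → dist G e₁ x ≤ m ∸ j → j < pos x
    reach-right j<m {x} d≤ with x ≟ᶠ e₁
    ... | yes refl = subst (j <_) (≡-sym pos-e₁) j<m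
    ... | no ne    = ≰⇒> λ x≤j → <⇒≱
      (m+n≤o⇒m≤o (suc (m ∸ pos x)) (subst (_≤ m ∸ j) (trans (dist-e₁ ne) (+-suc (m ∸ pos x) (h x))) d≤))
      (∸-monoʳ-≤ m x≤j)

    reach-leaf : ∀ {w x} → Leaf w → dist G w x ≤ 1 → x ≡ w ⊎ x ≡ s (pos w)
    reach-leaf {w} {x} lw d≤ with x ≟ᶠ w
    ... | yes e = inj₁ e
    ... | no ne with kind x | subst (_≤ 1) (trans (dist-diff (ne ∘ ≡-sym)) (trans
                  (cong (λ a → ∣ pos w - pos x ∣ + (a + h x)) (leaf⇒h≡1 lw))
                    (+-suc ∣ pos w - pos x ∣ (h x)))) d≤
    ...   | inj₁ (_ , hx) | s≤s le = contradiction
      (≤-trans (≤-reflexive (≡-sym hx)) (≤-trans (m≤n+m (h x) ∣ pos w - pos x ∣) le)) λ ()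
    ...   | inj₂ (nx , _) | s≤s le = inj₂ (trans (≡-sym (s-pos x nx)) (cong s
      (≡-sym (∣m-n∣≡0⇒m≡n (n≤0⇒n≡0 (m+n≤o⇒m≤o ∣ pos w - pos x ∣ le))))))

    reach-spine-1 : ∀ {w x} → NonLeaf w → ℓ (pos w) ≡ 0 → dist G w x ≤ 1 →
      NonLeaf x × ∣ pos w - pos x ∣ ≤ 1
    reach-spine-1 {w} {x} nw e d≤ with x ≟ᶠ w
    ... | yes refl = nw , ≤-trans (≤-reflexive (∣n-n∣≡0 (pos x))) z≤n
    ... | no ne = by-kind (kind x)
      where
      δ≤1 : ∣ pos w - pos x ∣ + h x ≤ 1
      δ≤1 = subst (_≤ 1) (trans (dist-diff (ne ∘ ≡-sym))
        (cong (λ a → ∣ pos w - pos x ∣ + (a + h x)) (nonleaf⇒h≡0 nw))) d≤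
      by-kind : (Leaf x × h x ≡ 1) ⊎ (NonLeaf x × h x ≡ 0) → NonLeaf x × ∣ pos w - pos x ∣ ≤ 1
      by-kind (inj₂ (nx , _))  = nx , m+n≤o⇒m≤o ∣ pos w - pos x ∣ δ≤1
      by-kind (inj₁ (lx , hx)) = contradiction (1≤ℓ lx (≡-sym (∣m-n∣≡0⇒m≡n (n≤0⇒n≡0
        (≤-pred (subst (_≤ 1) (trans (cong (∣ pos w - pos x ∣ +_) hx) (+-comm ∣ pos w - pos x ∣ 1)) δ≤1))))))
        (λ le → contradiction (subst (1 ≤_) e le) λ ())

    bare⇒inner : ∀ {k} → ℓ k ≡ 0 → i ≤ k → k ≤ j → i < k × k < j
    bare⇒inner e i≤ ≤j = ≤∧≢⇒< i≤ (λ { refl → contradiction (subst (2 ≤_) e 2≤ℓi) λ () })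
      , ≤∧≢⇒< ≤j (λ { refl → contradiction (subst (2 ≤_) e 2≤ℓj) λ () })

    bare⇒¬heavy : ∀ {k} → k < j → ℓ k ≡ 0 → ¬ Heavy k
    bare⇒¬heavy k<j e hv with heavy⇒leaf (≤-trans (s≤s z≤n) (≤-trans k<j j≤m)) (<⇒≤ (≤-trans k<j j≤m)) hv
    ... | x , lx , px , _ = contradiction (subst (1 ≤_) e (1≤ℓ lx px)) λ ()

    -- Both ends of the segment carry leaves, so bare vertices lie strictly inside; there a heavy
    -- vertex would have a leaf. Two consecutive bare vertices would thus form an excluded light
    -- pair.
    no-bare-pair : ∀ {k} → ℓ k ≡ 0 → ℓ (suc k) ≡ 0 → i ≤ k → suc k ≤ j → ⊥
    no-bare-pair {k} e e′ i≤k k<j =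
      noLightPair k (proj₁ (bare⇒inner e i≤k (<⇒≤ k<j))) k<j (bare⇒¬heavy k<j e)
        (bare⇒¬heavy (proj₂ (bare⇒inner e′ (m≤n⇒m≤1+n i≤k) k<j)) e′)

    bare-adjacent : ∀ {k l} → ℓ k ≡ 0 → ℓ l ≡ 0 → i ≤ k → k ≤ j → i ≤ l → l ≤ j → ∣ k - l ∣ ≤ 1 → k ≡ l
    bare-adjacent {k} {l} e e′ i≤k k≤j i≤l l≤j d≤ with <-cmp k l
    ... | tri≈ _ k≡l _ = k≡l
    ... | tri< k<l _ _ with m≤n⇒∃[o]m+o≡n k<l
    ...   | zero  , refl rewrite +-identityʳ k = ⊥-elim (no-bare-pair e e′ i≤k l≤j)
    ...   | suc o , refl = contradiction (subst (_≤ 1)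
      (trans (cong (∣ k -_∣) (≡-sym (+-suc k (suc o)))) (∣m-m+n∣≡n k (suc (suc o)))) d≤) λ { (s≤s ()) }
    bare-adjacent {k} {l} e e′ i≤k k≤j i≤l l≤j d≤ | tri> _ _ l<k with m≤n⇒∃[o]m+o≡n l<k
    ...   | zero  , refl rewrite +-identityʳ l = ⊥-elim (no-bare-pair e′ e i≤l k≤j)
    ...   | suc o , refl = contradiction (subst (_≤ 1) (trans (∣-∣-comm (suc l + suc o) l)
      (trans (cong (∣ l -_∣) (≡-sym (+-suc l (suc o)))) (∣m-m+n∣≡n l (suc (suc o))))) d≤) λ { (s≤s ()) }

    Private : Vertex G → Set
    Private w = ∃ λ u → OnlyDominator G f w u × (f w ≤ dist G w u ⊎ f w ≤ 1)

    -- The private vertex is `s (i - 1)`, at distance exactly `i`. Leaves of the segment reach only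
    -- their own spine vertex, and bare vertices have positions greater than `i`, too far to the
    -- right.
    private-left : 1 ≤ i → f e₀ ≡ i → Private e₀
    private-left 1≤i fw with m≤n⇒∃[o]m+o≡n 1≤i
    ... | i′ , refl = s i′ , only
      , inj₁ (≤-reflexive (trans fw (≡-sym (trans (dist-e₀ (leaf≢s i′ leaf-e₀ ∘ ≡-sym))
          (trans (cong₂ (λ a b → a + (1 + b)) (pos-s i′≤m) (h-s i′)) (+-comm i′ 1))))))
      where
      i′≤m : i′ ≤ m
      i′≤m = ≤-trans (n≤1+n i′) (≤-trans i≤j j≤m)
      only : OnlyDominator G f e₀ (s i′)
      only x 1≤fx d≤ with source x 1≤fx
      ... | left e _ _ = e
      ... | right refl j<m fx = contradiction
        (subst (j <_) (pos-s i′≤m) (reach-right j<m (subst (dist G e₁ (s i′) ≤_) fx d≤)))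
        (≤⇒≯ (≤-trans (n≤1+n i′) i≤j))
      ... | leaf lx i≤ _ fx with reach-leaf lx (subst (dist G x (s i′) ≤_) fx d≤)
      ...   | inj₁ e = ⊥-elim (leaf≢s i′ lx (≡-sym e))
      ...   | inj₂ e = contradiction (subst (suc i′ ≤_) (≡-sym (s-injective i′≤m (pos≤m x) e)) i≤) 1+n≰n
      only x 1≤fx d≤ | spine nx i≤ ≤j e fx
        with m≤n⇒∃[o]m+o≡n (proj₁ (bare⇒inner e i≤ ≤j))
           | proj₂ (reach-spine-1 nx e (subst (dist G x (s i′) ≤_) fx d≤))
      ... | o , po | near = contradiction (subst (_≤ 1) far near) λ { (s≤s ()) }
        where
        far : ∣ pos x - pos (s i′) ∣ ≡ suc (suc o)
        far = trans (cong₂ ∣_-_∣ (trans (≡-sym po)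
          (≡-sym (trans (+-suc i′ (suc o)) (cong suc (+-suc i′ o))))) (pos-s i′≤m))
          (∣m+n-m∣≡n i′ (suc (suc o)))

    private-right : suc j ≤ m → f e₁ ≡ m ∸ j → Private e₁
    private-right j<m fw = s (suc j) , only
      , inj₁ (≤-reflexive (trans fw (≡-sym (trans (dist-e₁ (leaf≢s (suc j) leaf-e₁ ∘ ≡-sym))
          (trans (cong₂ (λ a b → (m ∸ a) + (1 + b)) (pos-s j<m) (h-s (suc j)))
            (trans (+-comm (m ∸ suc j) 1) (≡-sym (m∸n≡1+[m∸1+n] j<m))))))))
      where
      only : OnlyDominator G f e₁ (s (suc j))
      only x 1≤fx d≤ with source x 1≤fx
      ... | right e _ _ = e
      ... | left refl 1≤i fx = contradiction
        (subst (_< i) (pos-s j<m) (reach-left 1≤i (subst (dist G e₀ (s (suc j)) ≤_) fx d≤)))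
        (≤⇒≯ (m≤n⇒m≤1+n i≤j))
      ... | leaf lx _ ≤j fx with reach-leaf lx (subst (dist G x (s (suc j)) ≤_) fx d≤)
      ...   | inj₁ e = ⊥-elim (leaf≢s (suc j) lx (≡-sym e))
      ...   | inj₂ e = contradiction (subst (_≤ j) (≡-sym (s-injective j<m (pos≤m x) e)) ≤j) 1+n≰n
      only x 1≤fx d≤ | spine nx i≤ ≤j e fx
        with m≤n⇒∃[o]m+o≡n (proj₂ (bare⇒inner e i≤ ≤j))
           | proj₂ (reach-spine-1 nx e (subst (dist G x (s (suc j)) ≤_) fx d≤))
      ... | o , po | near = contradiction (subst (_≤ 1) far near) λ { (s≤s ()) }
        where
        far : ∣ pos x - pos (s (suc j)) ∣ ≡ suc (suc o)
        far = trans (cong (∣ pos x -_∣) (trans (pos-s j<m)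
          (trans (cong suc (≡-sym po)) (≡-sym (trans (+-suc (pos x) (suc o)) (cong suc (+-suc (pos x) o)))))))
          (∣m-m+n∣≡n (pos x) (suc (suc o)))

    private-leaf : ∀ {w} → Leaf w → i ≤ pos w → pos w ≤ j → f w ≡ 1 → Private w
    private-leaf {w} lw i≤w w≤j fw = w , only , inj₂ (≤-reflexive fw)
      where
      only : OnlyDominator G f w w
      only x 1≤fx d≤ with source x 1≤fx
      ... | left refl 1≤i fx = contradiction (reach-left 1≤i (subst (dist G e₀ w ≤_) fx d≤)) (≤⇒≯ i≤w)
      ... | right refl j<m fx = contradiction (reach-right j<m (subst (dist G e₁ w ≤_) fx d≤)) (≤⇒≯ w≤j)
      ... | leaf lx _ _ fx = [ ≡-sym , (λ e → ⊥-elim (leaf≢s _ lw e)) ]′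
        (reach-leaf lx (subst (dist G x w ≤_) fx d≤))
      ... | spine nx _ _ e fx = ⊥-elim (true≢false lw
          (proj₁ (reach-spine-1 nx e (subst (dist G x w ≤_) fx d≤))))

    -- A bare vertex hears no leaf of the segment, since it has none of its own, and no other bare
    -- vertex, since no two are consecutive.
    private-spine : ∀ {w} → NonLeaf w → i ≤ pos w → pos w ≤ j → ℓ (pos w) ≡ 0 → f w ≡ 1 → Private w
    private-spine {w} nw i≤w w≤j ew fw = w , only , inj₂ (≤-reflexive fw)
      where
      only : OnlyDominator G f w w
      only x 1≤fx d≤ with source x 1≤fx
      ... | left refl 1≤i fx = contradiction (reach-left 1≤i (subst (dist G e₀ w ≤_) fx d≤)) (≤⇒≯ i≤w)
      ... | right refl j<m fx = contradiction (reach-right j<m (subst (dist G e₁ w ≤_) fx d≤)) (≤⇒≯ w≤j)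
      ... | leaf lx _ _ fx = [ ≡-sym , (λ e → contradiction (subst (1 ≤_) ew
          (1≤ℓ lx (≡-sym (trans (cong pos e) (pos-s (pos≤m x)))))) λ ()) ]′
        (reach-leaf lx (subst (dist G x w ≤_) fx d≤))
      ... | spine nx i≤x x≤j ex fx = trans (≡-sym (s-pos x nx)) (trans (cong s
          (bare-adjacent ex ew i≤x x≤j i≤w w≤j (proj₂ (reach-spine-1 nx ex (subst (dist G x w ≤_) fx d≤)))))
          (s-pos w nw))

    priv : ∀ w → 1 ≤ f w → Private w
    priv w 1≤ with source w 1≤
    ... | left refl 1≤i fw      = private-left 1≤i fw
    ... | right refl j<m fw     = private-right j<m fw
    ... | leaf lw i≤ ≤j fw      = private-leaf lw i≤ ≤j fw
    ... | spine nw i≤ ≤j ew fw  = private-spine nw i≤ ≤j ew fw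

    broadcast : IsBroadcast G f
    broadcast w with 1 ≤? f w
    ... | no ¬1≤ = ≤-trans (≤-pred (≰⇒> ¬1≤)) z≤n
    ... | yes 1≤ with priv w 1≤
    ...   | u , _ , inj₁ le = ≤-trans le (dist≤ecc w u)
    ...   | _ , _ , inj₂ le = ≤-trans le (1≤ecc w)

    Dominated : Vertex G → Set
    Dominated x = Σ (Vertex G) λ v → 1 ≤ f v × dist G v x ≤ f v

    self-dominated : ∀ {x} → f x ≡ 1 → Dominated x
    self-dominated {x} fx = x , ≤-reflexive (≡-sym fx) , subst (_≤ f x) (≡-sym (dist-same x)) z≤n

    -- The only leaves that e₀ could miss sit at i - 1, and such a leaf makes i - 1 and i both heavy.
    dominated-left : ∀ x → pos x < i → Dominated x
    dominated-left x lt with x ≟ᶠ e₀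
    ... | yes refl = e₀ , subst (1 ≤_) (≡-sym (f-e₀ (≤-trans (s≤s z≤n) lt))) (≤-trans (s≤s z≤n) lt)
      , subst (_≤ f e₀) (≡-sym (dist-same e₀)) z≤n
    ... | no ne = e₀ , subst (1 ≤_) (≡-sym fe) 1≤i
      , subst₂ _≤_ (≡-sym (trans (dist-e₀ ne) (+-suc (pos x) (h x)))) (≡-sym fe) (close (kind x))
      where
      1≤i : 1 ≤ i
      1≤i = ≤-trans (s≤s z≤n) lt
      fe : f e₀ ≡ i
      fe = f-e₀ 1≤i
      1≤m : 1 ≤ m
      1≤m = ≤-trans 1≤i (≤-trans i≤j j≤m)
      heavy-x : Leaf x → Heavy (pos x)
      heavy-x lx with 1 ≤? pos x
      ... | yes 1≤x = heavy-inner 1≤x (≤-trans lt (≤-trans i≤j j≤m)) lx refl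
      ... | no ¬1≤x = heavy-double 1≤m (pos≤m x) lx leaf-e₀ refl
        (trans pos-e₀ (≡-sym (n≤0⇒n≡0 (≤-pred (≰⇒> ¬1≤x))))) ne
      close : (Leaf x × h x ≡ 1) ⊎ (NonLeaf x × h x ≡ 0) → suc (pos x + h x) ≤ i
      close (inj₂ (_ , hx)) = subst (λ a → suc a ≤ i)
        (≡-sym (trans (cong (pos x +_) hx) (+-identityʳ (pos x)))) lt
      close (inj₁ (lx , hx)) with m≤n⇒m<n∨m≡n lt
      ... | inj₁ lt′ = subst (λ a → suc a ≤ i) (≡-sym (trans (cong (pos x +_) hx) (+-comm (pos x) 1))) lt′
      ... | inj₂ e   = ⊥-elim (noHeavyPair (pos x) (subst (_≤ m) (≡-sym e) (≤-trans i≤j j≤m)) (heavy-x lx)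
        (subst Heavy (≡-sym e) (2≤ℓ⇒heavy 1≤m (≤-trans i≤j j≤m) 2≤ℓi)))

    dominated-right : ∀ x → j < pos x → Dominated x
    dominated-right x lt with x ≟ᶠ e₁
    ... | yes refl = e₁ , subst (1 ≤_) (≡-sym (f-e₁ (≤-trans lt (pos≤m e₁))))
        (m<n⇒0<n∸m (≤-trans lt (pos≤m e₁)))
      , subst (_≤ f e₁) (≡-sym (dist-same e₁)) z≤n
    ... | no ne = e₁ , subst (1 ≤_) (≡-sym fe) (m<n⇒0<n∸m j<m)
      , subst₂ _≤_ (≡-sym (trans (dist-e₁ ne) (+-suc (m ∸ pos x) (h x)))) (≡-sym fe) (close (kind x))
      where
      j<m : j < m
      j<m = ≤-trans lt (pos≤m x)
      fe : f e₁ ≡ m ∸ j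
      fe = f-e₁ j<m
      1≤m : 1 ≤ m
      1≤m = ≤-trans (s≤s z≤n) j<m
      heavy-x : Leaf x → Heavy (pos x)
      heavy-x lx with m≤n⇒m<n∨m≡n (pos≤m x)
      ... | inj₁ x<m = heavy-inner (≤-trans (s≤s z≤n) lt) x<m lx refl
      ... | inj₂ e   = heavy-double 1≤m (pos≤m x) lx leaf-e₁ refl (trans pos-e₁ (≡-sym e)) ne
      close : (Leaf x × h x ≡ 1) ⊎ (NonLeaf x × h x ≡ 0) → suc ((m ∸ pos x) + h x) ≤ m ∸ j
      close (inj₂ (_ , hx)) = subst (λ a → suc a ≤ m ∸ j)
        (≡-sym (trans (cong (m ∸ pos x +_) hx) (+-identityʳ (m ∸ pos x))))
        (∸-monoʳ-< lt (pos≤m x))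
      close (inj₁ (lx , hx)) with m≤n⇒m<n∨m≡n lt
      ... | inj₁ lt′ = subst (λ a → suc a ≤ m ∸ j)
          (≡-sym (trans (cong (m ∸ pos x +_) hx) (+-comm (m ∸ pos x) 1)))
        (≤-trans (s≤s (∸-monoʳ-< lt′ (pos≤m x))) (≤-reflexive (≡-sym (m∸n≡1+[m∸1+n] j<m))))
      ... | inj₂ e   = ⊥-elim (noHeavyPair j j<m (2≤ℓ⇒heavy 1≤m j≤m 2≤ℓj)
          (subst Heavy (≡-sym e) (heavy-x lx)))

    dominated-inner : ∀ x → i ≤ pos x → pos x ≤ j → Dominated x
    dominated-inner x i≤ ≤j with kind x
    ... | inj₁ (lx , _) = self-dominated (f-leaf lx i≤ ≤j)
    ... | inj₂ (nx , _) with 1 ≤? ℓ (pos x)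
    ...   | no ¬1≤ = self-dominated (f-spine nx i≤ ≤j (n≤0⇒n≡0 (≤-pred (≰⇒> ¬1≤))))
    ...   | yes 1≤ with one-leaf (pos≤m x) 1≤
    ...     | y , ly , py = y , ≤-reflexive (≡-sym fy) , subst₂ _≤_ (≡-sym d≡1) (≡-sym fy) ≤-refl
      where
      fy : f y ≡ 1
      fy = f-leaf ly (subst (i ≤_) (≡-sym py) i≤) (subst (_≤ j) (≡-sym py) ≤j)
      d≡1 : dist G y x ≡ 1
      d≡1 = trans (cong (dist G y) (≡-sym (s-pos x nx))) (trans (dist-s y (pos≤m x))
        (cong₂ _+_ (trans (cong (∣_- pos x ∣) py) (∣n-n∣≡0 (pos x))) (leaf⇒h≡1 ly)))

    dominating : Dominating G f
    dominating x with pos x <? i | j <? pos x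
    ... | yes lt | _      = dominated-left x lt
    ... | no _   | yes lt = dominated-right x lt
    ... | no i≤  | no ≤j  = dominated-inner x (≮⇒≥ i≤) (≮⇒≥ ≤j)

    minimal : MinimalDominating G f
    minimal = private⇒minimal G f broadcast dominating priv

    costTo : ℕ → ℕ
    costTo = partial pos f

    costTo-left : i ≤ costTo i
    costTo-left with 1 ≤? i
    ... | no ¬1≤ = ≤-trans (≤-pred (≰⇒> ¬1≤)) z≤n
    ... | yes 1≤i = ≤-trans (m≤n+m i (costTo 0)) (partial-single pos f e₀ i z≤n
      (subst (_< i) (≡-sym pos-e₀) 1≤i) (≤-reflexive (≡-sym (f-e₀ 1≤i))))

    costTo-leaves : ∀ {k} → i ≤ k → k ≤ j → costTo k + ℓ k ≤ costTo (suc k)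
    costTo-leaves {k} i≤ ≤j = subst (λ a → costTo k + a ≤ costTo (suc k)) (≡-sym (countF≡sumF (leafAt k)))
      (partial-lower pos f (λ x → ind (leafAt k x)) (n≤1+n k) pointwise)
      where
      pointwise : ∀ x → ind (leafAt k x) ≡ 0 ⊎ (k ≤ pos x × pos x < suc k × ind (leafAt k x) ≤ f x)
      pointwise x with leafAt k x in eq
      ... | false = inj₁ refl
      ... | true with leafAt⁻ (≤-trans ≤j j≤m) eq
      ...   | lx , refl = inj₂ (≤-refl , ≤-refl , ≤-reflexive (≡-sym (f-leaf lx i≤ ≤j)))

    -- Every position of the segment contributes at least 1, from a leaf or, if there is none, from
    -- the spine vertex itself.
    costTo-step : ∀ {k} → i ≤ k → k ≤ j → suc (costTo k) ≤ costTo (suc k)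
    costTo-step {k} i≤ ≤j with 1 ≤? ℓ k
    ... | yes 1≤ = ≤-trans (≤-reflexive (+-comm 1 (costTo k))) (≤-trans (+-monoʳ-≤ (costTo k) 1≤)
        (costTo-leaves i≤ ≤j))
    ... | no ¬1≤ = ≤-trans (≤-reflexive (+-comm 1 (costTo k))) (partial-single pos f (s k) 1
      (≤-reflexive (≡-sym pk)) (s≤s (≤-reflexive pk)) (≤-reflexive (≡-sym fk)))
      where
      pk : pos (s k) ≡ k
      pk = pos-s (≤-trans ≤j j≤m)
      fk : f (s k) ≡ 1
      fk = f-spine (s-nonleaf k) (subst (i ≤_) (≡-sym pk) i≤) (subst (_≤ j) (≡-sym pk) ≤j)
        (trans (cong ℓ pk) (n≤0⇒n≡0 (≤-pred (≰⇒> ¬1≤))))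

    costTo-right : costTo (suc j) + (m ∸ j) ≤ cost G f
    costTo-right with suc j ≤? m
    ... | yes j<m = ≤-trans (partial-single pos f e₁ (m ∸ j) (subst (suc j ≤_) (≡-sym pos-e₁) j<m)
      (s≤s (pos≤m e₁)) (≤-reflexive (≡-sym (f-e₁ j<m)))) (partial-≤sumF pos f (suc m))
    ... | no ¬j<m = subst (λ a → costTo (suc j) + a ≤ cost G f) (≡-sym (m≤n⇒m∸n≡0 (≤-pred (≰⇒> ¬j<m))))
      (≤-trans (≤-reflexive (+-identityʳ _)) (partial-≤sumF pos f (suc j)))

    -- The right end adds `m - j`, for a total of at least `m + 3`.
    cost-lower : 3 + j ≤ costTo (suc j) → m + 2 < cost G f
    cost-lower le = ≤-trans (≤-reflexive (trans (cong suc (+-comm m 2))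
      (cong (3 +_) (≡-sym (m+[n∸m]≡n j≤m))))) (≤-trans (+-monoˡ-≤ (m ∸ j) le) costTo-right)

    cost-three-leaves : i ≡ j → 3 ≤ ℓ i → m + 2 < cost G f
    cost-three-leaves refl 3≤ = cost-lower (≤-trans (≤-reflexive (+-comm 3 j))
      (≤-trans (+-mono-≤ costTo-left 3≤) (costTo-leaves ≤-refl ≤-refl)))

    -- The positions `i` and `j` contribute at least 2 each and those between at least 1, so with
    -- the `i` from the left the sum up to `j` is at least `j + 3`.
    cost-two-ends : i < j → m + 2 < cost G f
    cost-two-ends i<j = cost-lower (≤-trans (≤-reflexive (cong suc (+-comm 2 j)))
      (≤-trans (+-mono-≤ (climb j i<j ≤-refl) 2≤ℓj) (costTo-leaves i≤j ≤-refl)))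
      where
      climb : ∀ k → i < k → k ≤ j → suc k ≤ costTo k
      climb (suc k) (s≤s i≤k) k≤j with m≤n⇒m<n∨m≡n i≤k
      ... | inj₁ i<k  = ≤-trans (s≤s (climb k i<k (<⇒≤ k≤j))) (costTo-step i≤k (<⇒≤ k≤j))
      ... | inj₂ refl = ≤-trans (≤-reflexive (+-comm 2 i))
        (≤-trans (+-mono-≤ costTo-left 2≤ℓi) (costTo-leaves ≤-refl i≤j))

-- The three conditions in spine coordinates, and the equivalence.

module Characterisation (G : Graph) (S : Spine G) (v : ℕ → Vertex G)
  (v-s : ∀ j → j ≤ Spine.m S → v (suc j) ≡ Spine.s S j)
  (v-injective : ∀ i j → i ≤ 2 + Spine.m S → j ≤ 2 + Spine.m S → v i ≡ v j → i ≡ j) where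
  open SpineDegrees G S
  open UpperBound G S using (NoLightPair; cost≤m+2)
  open Constructions G S

  Excess : Set
  Excess = ∃ λ f → MinimalDominating G f × m + 2 < cost G f

  light⇒deg≡2 : ∀ {j} → j ≤ m → ¬ Heavy j → deg G (s j) ≡ 2
  light⇒deg≡2 j≤ ¬hv = ≤-antisym (≤-pred (≰⇒> ¬hv)) (2≤deg j≤)

  deg≡2⇒light : ∀ {j} → deg G (s j) ≡ 2 → ¬ Heavy j
  deg≡2⇒light e hv = contradiction (subst (3 ≤_) e hv) 1+n≰n

  module Sufficiency (cI : CondI G (2 + m) v) (cII : CondII G (2 + m) v) (cIII : CondIII G (2 + m) v) where

    atMost2 : ∀ j → j ≤ m → ℓ j ≤ 2
    atMost2 j j≤ = subst (λ x → leafNeighbours G x ≤ 2) (v-s j j≤) (cI (suc j) (s≤s z≤n) (s≤s j≤))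

    noHeavyPair : ∀ j → suc j ≤ m → Heavy j → Heavy (suc j) → ⊥
    noHeavyPair j j< hv hv′ = contradiction (subst (3 ≤_) min≡2 (⊓-glb hv hv′)) 1+n≰n
      where
      min≡2 : deg G (s j) ⊓ deg G (s (suc j)) ≡ 2
      min≡2 = subst₂ (λ x y → deg G x ⊓ deg G y ≡ 2) (v-s j (<⇒≤ j<)) (v-s (suc j) j<)
        (cII (suc j) (s≤s z≤n) j<)

    lightPair : ∀ p q → p < q → q ≤ m → 2 ≤ ℓ p → 2 ≤ ℓ q → ¬ NoLightPair p q
    lightPair p q p<q q≤m 2≤p 2≤q none
      with cIII (suc p) (suc q) (s≤s p<q) (s≤s (m≤n⇒m≤1+n q≤m))
        (subst (λ x → 2 ≤ leafNeighbours G x) (≡-sym (v-s p (≤-trans (<⇒≤ p<q) q≤m))) 2≤p)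
        (subst (λ x → 2 ≤ leafNeighbours G x) (≡-sym (v-s q q≤m)) 2≤q)
    ... | suc k , s≤s p<k , s≤s k<q , dk , dsk = none k p<k k<q
      (deg≡2⇒light (trans (cong (deg G) (≡-sym (v-s k (≤-trans (<⇒≤ k<q) q≤m)))) dk))
      (deg≡2⇒light (trans (cong (deg G) (≡-sym (v-s (suc k) (≤-trans k<q q≤m)))) dsk))

    upper : ∀ f → MinimalDominating G f → cost G f ≤ m + 2
    upper f min = cost≤m+2 atMost2 noHeavyPair lightPair f (λ w → proj₁ (chosen w))
      (λ w 1≤ → proj₁ (proj₂ (chosen w) 1≤)) (λ w 1≤ → proj₂ (proj₂ (chosen w) 1≤))
      where
      chosen : ∀ w → ∃ λ u → 1 ≤ f w →
        OnlyDominator G f w u × ((w ≢ u × dist G w u ≡ f w) ⊎ (u ≡ w × f w ≡ 1))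
      chosen w with 1 ≤? f w
      -- A default value: nothing is required of the private vertex when `f w` is 0.
      ... | no ¬1≤ = w , λ 1≤ → contradiction 1≤ ¬1≤
      ... | yes 1≤ with minimal⇒private G S min w 1≤
      ...   | u , pr = u , λ _ → pr

    number : UpperBroadcastNumberIs G (m + 2)
    number = diametrical-broadcast , upper

  module Necessity (¬excess : ¬ Excess) where

    noHeavyPair : ∀ j → suc j ≤ m → Heavy j → Heavy (suc j) → ⊥
    noHeavyPair j j< hv hv′ = ¬excess (HeavyPair.f j< hv hv′ , HeavyPair.minimal j< hv hv′
      , ≤-reflexive (≡-sym (HeavyPair.cost≡ j< hv hv′)))

    atMost2 : ∀ j → j ≤ m → ℓ j ≤ 2
    atMost2 j j≤ with ℓ j ≤? 2
    ... | yes le = le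
    ... | no ¬le = contradiction (L.f , L.minimal , L.cost-three-leaves refl 3≤) ¬excess
      where
      3≤ : 3 ≤ ℓ j
      3≤ = ≰⇒> ¬le
      -- The segment consists of the single position `j`, so the condition on light pairs is
      -- vacuous.
      module L = LeafSegment ≤-refl j≤ (<⇒≤ 3≤) (<⇒≤ 3≤) noHeavyPair
        (λ k j<k k<j _ _ → <-asym j<k k<j)

    -- The search for a light pair ranges over finitely many positions; if it fails, the segment
    -- from `p` to `q` yields a broadcast that is too expensive.
    light-pair : ∀ p q → p < q → q ≤ m → 2 ≤ ℓ p → 2 ≤ ℓ q →
      ∃ λ k → p < k × k < q × deg G (s k) ≡ 2 × deg G (s (suc k)) ≡ 2
    light-pair p q p<q q≤m 2≤p 2≤q
      with any? {n = q} (λ k → (p <? toℕ k) ×-dec (¬? (3 ≤? deg G (s (toℕ k))) ×-dec ¬?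
        (3 ≤? deg G (s (suc (toℕ k))))))
    ... | yes (k , p<k , ¬hk , ¬hsk) = toℕ k , p<k , toℕ<n k
      , light⇒deg≡2 (≤-trans (<⇒≤ (toℕ<n k)) q≤m) ¬hk , light⇒deg≡2 (≤-trans (toℕ<n k) q≤m) ¬hsk
    ... | no none = contradiction (L.f , L.minimal , L.cost-two-ends p<q) ¬excess
      where
      noLightPair : NoLightPair p q
      noLightPair k p<k k<q ¬hk ¬hsk = none (fromℕ< k<q ,
        subst (λ z → p < z × ¬ Heavy z × ¬ Heavy (suc z)) (≡-sym (toℕ-fromℕ< k<q)) (p<k , ¬hk , ¬hsk))
      module L = LeafSegment (<⇒≤ p<q) q≤m 2≤p 2≤q noHeavyPair noLightPair

    condI : CondI G (2 + m) v
    condI (suc j) _ (s≤s j≤) = subst (λ x → leafNeighbours G x ≤ 2) (≡-sym (v-s j j≤)) (atMost2 j j≤)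

    condII : CondII G (2 + m) v
    condII (suc j) _ j< = subst₂ (λ x y → deg G x ⊓ deg G y ≡ 2)
      (≡-sym (v-s j (<⇒≤ j<))) (≡-sym (v-s (suc j) j<))
      (≤-antisym min≤2 (⊓-glb (2≤deg (<⇒≤ j<)) (2≤deg j<)))
      where
      min≤2 : deg G (s j) ⊓ deg G (s (suc j)) ≤ 2
      min≤2 with 3 ≤? deg G (s j) | 3 ≤? deg G (s (suc j))
      ... | yes hv | yes hv′ = ⊥-elim (noHeavyPair j j< hv hv′)
      ... | no ¬hv | _       = m≤n⇒m⊓o≤n _ (≤-pred (≰⇒> ¬hv))
      ... | yes _  | no ¬hv′ = m≤n⇒o⊓m≤n _ (≤-pred (≰⇒> ¬hv′))

    -- Condition (iii) also ranges over the ends of the path. A vertex with a leaf neighbour `x` is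
    -- `s (pos x)`, and injectivity of `v` turns this into an interior index.
    inner-index : ∀ {i} → i ≤ 2 + m → 2 ≤ leafNeighbours G (v i) → ∃ λ p → i ≡ suc p × p ≤ m
    inner-index {i} i≤ 2≤ with countF⇒∃ (λ x → adj G (v i) x ∧ isLeaf G x) (<⇒≤ 2≤)
    ... | x , ex with ∧-true⁻ {adj G (v i) x} ex
    ...   | a , lx = pos x
      , v-injective i (suc (pos x)) i≤ (s≤s (m≤n⇒m≤1+n (pos≤m x)))
          (trans (leaf-unique x (v i) lx (adj-sym G a)) (≡-sym (v-s (pos x) (pos≤m x))))
      , pos≤m x

    condIII : CondIII G (2 + m) v
    condIII i j i<j j≤ 2≤i 2≤j with inner-index (≤-trans (<⇒≤ i<j) j≤) 2≤i | inner-index j≤ 2≤j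
    ... | p , refl , p≤m | q , refl , q≤m with light-pair p q (≤-pred i<j) q≤m
      (subst (λ x → 2 ≤ leafNeighbours G x) (v-s p p≤m) 2≤i) (subst (λ x → 2 ≤ leafNeighbours G x)
        (v-s q q≤m) 2≤j)
    ...   | k , p<k , k<q , dk , dsk = suc k , s≤s p<k , s≤s k<q
      , trans (cong (deg G) (v-s k (≤-trans (<⇒≤ k<q) q≤m))) dk
      , trans (cong (deg G) (v-s (suc k) (≤-trans k<q q≤m))) dsk

  equivalence : UpperBroadcastNumberIs G (m + 2) ⇔ (CondI G (2 + m) v × CondII G (2 + m) v × CondIII G
    (2 + m) v)
  equivalence = mk⇔
    (λ { (_ , upper) → let ¬excess : ¬ Excess
                           ¬excess = λ { (f , min , lt) → <⇒≱ lt (upper f min) }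
                       in Necessity.condI ¬excess , Necessity.condII ¬excess , Necessity.condIII ¬excess })
    (λ { (cI , cII , cIII) → Sufficiency.number cI cII cIII })

theorem1p1 : (T : Graph) → IsCaterpillar T → (d : ℕ) → (v : ℕ → Vertex T) →
    IsDiametricalPath T d v →
    UpperBroadcastNumberIs T (diam T) ⇔ (CondI T d v × CondII T d v × CondIII T d v)
theorem1p1 T cat d v diametrical with oriented-spine cat diametrical
... | S , v-s = subst₂ (λ a b → UpperBroadcastNumberIs T a ⇔ (CondI T b v × CondII T b v × CondIII T b v))
  (≡-sym diam≡m+2) (≡-sym d≡2+m)
  (Characterisation.equivalence T S v v-s λ i j i≤ j≤ → proj₁ (proj₂ diametrical) i j (cast i≤) (cast j≤))
  where
  open SpineDistance T S using (m; diam≡m+2)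
  d≡2+m : d ≡ 2 + m
  d≡2+m = trans (proj₁ diametrical) (trans diam≡m+2 (+-comm m 2))
  cast : ∀ {i} → i ≤ 2 + m → i ≤ d
  cast le = ≤-trans le (≤-reflexive (≡-sym d≡2+m))
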